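{- Let $\mathcal F$ be a Fano plane, $\mathbb F$ a field of characteristic not $2$, and $n'\in V_{\mathcal F}^\ast$. For an $n'$-oriented map $\alpha$ write $e^\alpha$ for the multiplication factor $e^\alpha_{PQ}=(-1)^{\alpha_P(Q)}$ ($P\ne Q$) and $-e^\alpha$ for its negative. (i) If $\alpha\in\mathcal F_{n'}$, then $(\mathbb O_{\mathcal F},e^{n'},e^\alpha)\in\mathbb O_{\mathcal F}{}^+_{e^{n'}}$ and $(\mathbb O_{\mathcal F},e^{n'},-e^\alpha)\in\mathbb O_{\mathcal F}{}^-_{e^{n'}}$. (ii) If $(\mathbb O_{\mathcal F},e^{n'},\epsilon)\in\mathbb O_{\mathcal F}{}^+_{e^{n'}}$ (resp. $\in\mathbb O_{\mathcal F}{}^-_{e^{n'}}$), then there exists a unique $\alpha\in\mathcal F_{n'}$ such that $\epsilon=e^\alpha$ (resp. $\epsilon=-e^\alpha$).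
   Context: A Fano plane is a set $\mathcal F$ of seven points together with a set of seven $3$-element subsets of $\mathcal F$ called lines, such that any two distinct points lie in a unique line and any two distinct lines meet in a unique point. The Fano cube is $V_{\mathcal F}=\mathcal F\cup\{0\}$ with the unique $\mathbb Z_2$-vector space structure with zero $0$ such that for distinct $P,Q\in\mathcal F$, $P+Q$ is the third point of the line through $P$ and $Q$; $V_{\mathcal F}^\ast$ is its dual. For $n\in V_{\mathcal F}^\ast$, an $n$-oriented map is a map $\alpha:\mathcal F\to V_{\mathcal F}^\ast$, $P\mapsto\alpha_P$, with $\alpha_P(P)+n(P)=1$ for all $P\in\mathcal F$ and $\alpha_P(Q)+\alpha_Q(P)=1$ for all $P\ne Q$; $\mathcal F_n$ is the set of $n$-oriented maps. A norm on $\mathcal F$ is a map $N:\mathcal F\to\{ -1,1\}$ with $N(P+Q)=N(P)N(Q)$ for $P\ne Q$; $e^{n}$ denotes the norm $P\mapsto(-1)^{n(P)}$, and $\mathbf 1=e^0$. A multiplication factor is a map $\epsilon:\{(P,Q)\in\mathcal F^2:P\ne Q\}\to\{ -1,1\}$ with $\epsilon_{QP}=-\epsilon_{PQ}$; the future of $P$ is $\overrightarrow{P}=\{Q\ne P:\epsilon_{PQ}=1\}$ and the past is $\overleftarrow{P}=\{Q\ne P:\epsilon_{PQ}=-1\}$. $\mathbb O_{\mathcal F}$ is the $\mathbb F$-vector space of $\mathbb F$-valued functions on $V_{\mathcal F}$, with basis $e_P$ ($P\in V_{\mathcal F}$), $e_P$ the indicator function of $P$. Given a norm $N$ and $\epsilon$,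 the multiplication $\cdot_\epsilon$ is bilinear with $e_P\cdot_\epsilon e_Q=\epsilon_{PQ}e_{P+Q}$ for $P\ne Q$ in $\mathcal F$, $e_P\cdot_\epsilon e_P=-N(P)e_0$ for $P\in\mathcal F$, and $e_0$ a two-sided unit; the quadratic form is $N_{\mathbb O}(\lambda^0e_0+\sum_P\lambda^Pe_P)=(\lambda^0)^2+\sum_PN(P)(\lambda^P)^2$. $(\mathbb O_{\mathcal F},N,\epsilon)$ is a composition algebra iff $N_{\mathbb O}(Z\cdot_\epsilon W)=N_{\mathbb O}(Z)N_{\mathbb O}(W)$ for all $Z,W$. For $n'=0$: $\mathbb O_{\mathcal F}{}^{+}_{e^{0}}=\mathbb O_{\mathcal F}{}^+_1$ (resp. $\mathbb O_{\mathcal F}{}^-_1$) is the set of composition algebras $(\mathbb O_{\mathcal F},\mathbf 1,\epsilon)$ such that $\overrightarrow{P}$ (resp. $\overleftarrow{P}$) is a line for every $P\in\mathcal F$. For $n'\ne0$: $\mathbb O_{\mathcal F}{}^+_{e^{n'}}$ (resp. $\mathbb O_{\mathcal F}{}^-_{e^{n'}}$) is the set of composition algebras $(\mathbb O_{\mathcal F},e^{n'},\epsilon)$ for which there is a unique point $P_{n'}\in\mathcal F$ with $\overrightarrow{P_{n'}}=\mathcal F\setminus\{P_{n'}\}$ (resp. $\overleftarrow{P_{n'}}=\mathcal F\setminus\{P_{n'}\}$). -}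

module Defs where

open import Level using (Level; _⊔_) renaming (suc to lsuc)
open import Data.Bool using (Bool; true; false; _xor_; if_then_else_; T)
open import Data.Bool.Properties using (T?)
open import Data.Fin using (Fin; zero; suc)
import Data.Fin.Properties as FinP
open import Data.Nat using (ℕ; zero; suc)
open import Data.Maybe using (Maybe; just; nothing)
open import Data.Sign using (Sign) renaming (+ to ⁺; - to ⁻)
open import Data.Product using (Σ; ∃; ∃-syntax; ∃!; _×_; _,_; proj₁; proj₂)
open import Data.Sum using (_⊎_)
open import Relation.Nullary using (¬_; Dec; yes; no)
open import Relation.Nullary.Decidable using (_×-dec_; ¬?)
open import Relation.Binary.PropositionalEquality using (_≡_; _≢_; refl; sym; trans; cong)
open import Relation.Binary.Definitions using (DecidableEquality)
open import Function.Bundles using (_↔_; Inverse)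
open import Algebra.Bundles using (CommutativeRing)

record Field (c ℓ : Level) : Set (lsuc (c ⊔ ℓ)) where
  field
    commutativeRing : CommutativeRing c ℓ
  open CommutativeRing commutativeRing public
  field
    1≉0     : ¬ (1# ≈ 0#)
    inverse : ∀ x → ¬ (x ≈ 0#) → ∃[ y ] (x * y ≈ 1#)

CharNot2 : ∀ {c ℓ} → Field c ℓ → Set ℓ
CharNot2 K = ¬ (1# + 1# ≈ 0#) where open Field K

record FanoPlane : Set₁ where
  field
    Point : Set
    seven : Point ↔ Fin 7
    line  : Fin 7 → Point → Bool
    lines-distinct : ∀ i j → i ≢ j → ¬ (∀ P → line i P ≡ line j P)
    line-size3 : ∀ i → ∃[ a ] ∃[ b ] ∃[ c ]
                   (a ≢ b × a ≢ c × b ≢ c ×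
                    (∀ P → (line i P ≡ true) → (P ≡ a ⊎ P ≡ b ⊎ P ≡ c)) ×
                    line i a ≡ true × line i b ≡ true × line i c ≡ true)
    two-points : ∀ P Q → P ≢ Q →
                 ∃! _≡_ (λ i → line i P ≡ true × line i Q ≡ true)
    two-lines  : ∀ i j → i ≢ j →
                 ∃! _≡_ (λ P → line i P ≡ true × line j P ≡ true)

module _ (FP : FanoPlane) where
  open FanoPlane FP

  private
    module S = Inverse seven

  _≟P_ : DecidableEquality Point
  P ≟P Q with S.to P FinP.≟ S.to Q
  ... | yes e = yes (trans (sym (S.strictlyInverseʳ P))
                     (trans (cong S.from e) (S.strictlyInverseʳ Q)))
  ... | no ne = no (λ e → ne (cong S.to e))

  -- P + Q = R in the Fano cube, for points P ≠ Q:
  -- R is the third point of the line through P and Q.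
  IsSum : Point → Point → Point → Set
  IsSum P Q R = P ≢ Q × R ≢ P × R ≢ Q ×
                ∃[ i ] (line i P ≡ true × line i Q ≡ true × line i R ≡ true)

  isSum? : ∀ P Q R → Dec (IsSum P Q R)
  isSum? P Q R =
    ¬? (P ≟P Q) ×-dec ¬? (R ≟P P) ×-dec ¬? (R ≟P Q) ×-dec
    FinP.any? (λ i → (line i P Data.Bool.≟ true) ×-dec
                     (line i Q Data.Bool.≟ true) ×-dec
                     (line i R Data.Bool.≟ true))

  -- The Fano cube V_F = F ∪ {0}, with 0 = nothing.
  V : Set
  V = Maybe Point

  -- The dual V_F^* : Z₂-linear functionals on V_F (Z₂ = Bool, + = xor),
  -- given by their values on the points (the value at 0 is 0).
  IsLinear : (Point → Bool) → Set
  IsLinear n = ∀ P Q R → IsSum P Q R → n R ≡ n P xor n Q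

  Dual : Set
  Dual = Σ (Point → Bool) IsLinear

  IsZeroDual : Dual → Set
  IsZeroDual n = ∀ P → proj₁ n P ≡ false

  IsOriented : Dual → (Point → Dual) → Set
  IsOriented n α = (∀ P → proj₁ (α P) P xor proj₁ n P ≡ true) ×
                   (∀ P Q → P ≢ Q → proj₁ (α P) Q xor proj₁ (α Q) P ≡ true)

  Oriented : Dual → Set
  Oriented n = Σ (Point → Dual) (IsOriented n)

  sgnBool : Bool → Sign
  sgnBool false = ⁺
  sgnBool true  = ⁻

  normOf : Dual → Point → Sign
  normOf n P = sgnBool (proj₁ n P)

  -- A multiplication factor is represented by a function on all pairs;
  -- only its values on pairs P ≠ Q matter (diagonal values are ignored).
  MultFun : Set
  MultFun = Point → Point → Sign

  IsMultFactor : MultFun → Set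
  IsMultFactor ε = ∀ P Q → P ≢ Q → ε Q P ≡ Data.Sign.opposite (ε P Q)

  _≐_ : MultFun → MultFun → Set
  ε ≐ δ = ∀ P Q → P ≢ Q → ε P Q ≡ δ P Q

  eOf : (Point → Dual) → MultFun
  eOf α P Q = sgnBool (proj₁ (α P) Q)

  negeOf : (Point → Dual) → MultFun
  negeOf α P Q = Data.Sign.opposite (eOf α P Q)

  InFuture InPast : MultFun → Point → Point → Set
  InFuture ε P Q = Q ≢ P × ε P Q ≡ ⁺
  InPast   ε P Q = Q ≢ P × ε P Q ≡ ⁻

  IsLineSet : (Point → Set) → Set
  IsLineSet A = ∃[ i ] (∀ Q → (A Q → line i Q ≡ true) × (line i Q ≡ true → A Q))

  IsAllBut : Point → (Point → Set) → Set
  IsAllBut P A = ∀ Q → (A Q → Q ≢ P) × (Q ≢ P → A Q)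

  sumFin : ∀ {c} {A : Set c} → (A → A → A) → A → (k : ℕ) → (Fin k → A) → A
  sumFin _⊕_ z zero    f = z
  sumFin _⊕_ z (suc k) f = f zero ⊕ sumFin _⊕_ z k (λ i → f (suc i))

  module Alg {c ℓ} (K : Field c ℓ) where
    open Field K

    ΣP : (Point → Carrier) → Carrier
    ΣP f = sumFin _+_ 0# 7 (λ i → f (S.from i))

    sgn : Sign → Carrier → Carrier
    sgn ⁺ x = x
    sgn ⁻ x = - x

    𝕆 : Set c
    𝕆 = V → Carrier

    -- the multiplication ·_ε with norm N (bilinear extension of the rules
    -- e_P e_Q = ε_PQ e_{P+Q}, e_P e_P = -N(P) e_0, e_0 unit)
    mul : (Point → Sign) → MultFun → 𝕆 → 𝕆 → 𝕆
    mul N ε Z W nothing =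
      Z nothing * W nothing - ΣP (λ P → sgn (N P) (Z (just P) * W (just P)))
    mul N ε Z W (just R) =
      Z nothing * W (just R) + Z (just R) * W nothing +
      ΣP (λ P → ΣP (λ Q → term P Q))
      where
      term : Point → Point → Carrier
      term P Q with isSum? P Q R
      ... | yes _ = sgn (ε P Q) (Z (just P) * W (just Q))
      ... | no _  = 0#

    normQ : (Point → Sign) → 𝕆 → Carrier
    normQ N Z = Z nothing * Z nothing + ΣP (λ P → sgn (N P) (Z (just P) * Z (just P)))

    IsComposition : (Point → Sign) → MultFun → Set (c ⊔ ℓ)
    IsComposition N ε = ∀ Z W → normQ N (mul N ε Z W) ≈ normQ N Z * normQ N W

    InPlus : Dual → MultFun → Set (c ⊔ ℓ)
    InPlus n ε = IsMultFactor ε × IsComposition (normOf n) ε ×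
      ((IsZeroDual n → ∀ P → IsLineSet (InFuture ε P)) ×
       (¬ IsZeroDual n → ∃! _≡_ (λ P → IsAllBut P (InFuture ε P))))

    InMinus : Dual → MultFun → Set (c ⊔ ℓ)
    InMinus n ε = IsMultFactor ε × IsComposition (normOf n) ε ×
      ((IsZeroDual n → ∀ P → IsLineSet (InPast ε P)) ×
       (¬ IsZeroDual n → ∃! _≡_ (λ P → IsAllBut P (InPast ε P))))

  _≗α_ : (Point → Dual) → (Point → Dual) → Set
  α ≗α β = ∀ P Q → proj₁ (α P) Q ≡ proj₁ (β P) Q

{-# OPTIONS --safe #-}
module Submission where

-- Since any two lines meet, the Fano cube V is an elementary abelian 2-group. Write
-- e_x e_y = (-1)^F(x,y) e_(x+y) on all of V, so that F(P,P) = 1 + n(P). Comparing coefficients in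
-- N(ZW) = N(Z)N(W) shows that the algebra is a composition algebra iff, for all d ≠ 0,
--   n(d) + F(x,y) + F(x+d,y+d) = 1 + F(x,y+d) + F(x+d,y),
-- a condition which is stable under F(x,y) ↦ F(y,x), that is, under ε ↦ -ε on multiplication
-- factors; so only the case of + has to be treated. An n-oriented map is precisely an F that is
-- additive in y. For such an F the condition reduces to the orientation axioms. Conversely, for
-- n = 0 each F(P,-) is the functional with kernel the future of P, and for n ≠ 0 the defect of
-- additivity of F(x,-) on a line depends only on the coset of x modulo this line, which together
-- with its vanishing at x = 0 and at the given source forces it to be zero.

open import Defs
import Algebra.Properties.CommutativeSemigroup
import Algebra.Properties.Ring
import Algebra.Properties.Semiring.Sum
import Algebra.Solver.Ring.NaturalCoefficients.Default
open import Data.Bool using (Bool; true; false; not; _xor_)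
import Data.Bool.Properties as Bool
open import Data.Fin using (Fin; zero; suc; punchIn)
open import Data.Fin.Patterns using (0F; 1F)
open import Data.Fin.Permutation using (permutation)
import Data.Fin.Properties as Fin
open import Data.Maybe using (just; nothing)
import Data.Maybe.Properties as Maybe
open import Data.Nat using (ℕ; zero; suc)
open import Data.Product using (Σ; ∃; ∃-syntax; ∃!; _×_; _,_; proj₁; proj₂)
open import Data.Sign using (Sign)
import Data.Sign as Sign
import Data.Sign.Properties as Sign
open import Data.Sum using (_⊎_; inj₁; inj₂)
open import Function.Base using (_∘_; case_of_)
open import Function.Bundles using (Inverse; _↔_; mk↔ₛ′)
open import Level using (Level)
open import Relation.Binary.Definitions using (DecidableEquality)
open import Relation.Binary.PropositionalEquality as ≡ using (_≡_; _≢_)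
import Relation.Binary.Reasoning.Setoid
open import Relation.Nullary using (¬_; Dec; yes; no; contradiction)
open import Relation.Nullary.Decidable using (map′; _×-dec_; _→-dec_; from-yes)

-- Extending `F` to `0` and to the diagonal turns the product into one twisted convolution over the
-- cube, and the exchange identity then also covers zero and repeated arguments, from which values
-- on the diagonal can be extracted. Coefficients are compared by evaluation. At `Z = e_x + e_(x+d)`
-- and `W = e_y + e_(y+d)` the product lives on `x+y` and `x+y+d`, and composition becomes an
-- equation between signs, which can be solved because `2` is invertible. In the other direction,
-- `y ↦ y+d` pairs the terms with fixed `x` and `d ≠ 0` and reverses their sign. For `n ≠ 0` the
-- obstacle is a line through the source: modulo such a line `0` and the source lie in the same
-- coset, so the other coset is out of reach. There the defect at `x` is a sum of defects at the
-- same `x` on three other triples, chosen so that modulo each of them `x` is congruent to `0` or to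
-- the source.

isMinus : Sign → Bool
isMinus Sign.+ = false
isMinus Sign.- = true

-- Parity identities, checked by truth tables

all-Bool? : ∀ {p} {A : Bool → Set p} → (∀ b → Dec (A b)) → Dec (∀ b → A b)
all-Bool? A? = map′ (λ (t , f) → λ { true → t ; false → f }) (λ a → a true , a false)
  (A? true ×-dec A? false)

xor-true : ∀ {a b} → a xor b ≡ true → a ≡ not b
xor-true {true}  {false} _ = ≡.refl
xor-true {false} {true}  _ = ≡.refl

reverse-Bool : ∀ a b c → a xor (b xor c) ≡ c xor (b xor a)
reverse-Bool = from-yes (
  all-Bool? λ a → all-Bool? λ b → all-Bool? λ c →
  ((a xor (b xor c)) Bool.≟ (c xor (b xor a))))

solve-defect-Bool : ∀ a b c → a xor (b xor c) ≡ false → b ≡ a xor c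
solve-defect-Bool = from-yes (
  all-Bool? λ a → all-Bool? λ b → all-Bool? λ c →
  ((a xor (b xor c)) Bool.≟ false) →-dec (b Bool.≟ (a xor c)))

-- For `R = P+D` read `n = n(D)`, `r = α_R(D)`, `p = α_P(D)`, `p′ = α_D(P)`, `r′ = α_D(R)`,
-- `d = α_D(D)`.
column-Bool : ∀ n r p p′ r′ d → d ≡ not n → r ≡ not r′ → p ≡ not p′ → d ≡ p′ xor r′ →
  n xor r ≡ not p
column-Bool = from-yes (
  all-Bool? λ n → all-Bool? λ r → all-Bool? λ p → all-Bool? λ p′ → all-Bool? λ r′ →
  all-Bool? λ d →
  (d Bool.≟ (not n)) →-dec (r Bool.≟ (not r′)) →-dec (p Bool.≟ (not p′)) →-dec
  (d Bool.≟ (p′ xor r′)) →-dec ((n xor r) Bool.≟ (not p)))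

exchange-Bool : ∀ n a b c d → n xor c ≡ not d → n xor (a xor (b xor c)) ≡ not ((a xor d) xor b)
exchange-Bool = from-yes (
  all-Bool? λ n → all-Bool? λ a → all-Bool? λ b → all-Bool? λ c → all-Bool? λ d →
  ((n xor c) Bool.≟ (not d)) →-dec ((n xor (a xor (b xor c))) Bool.≟ not ((a xor d) xor b)))

-- The letters `a`, `b`, `c`, `z` are the exponents of `x` at `y`, `y+d`, `d`, `0`, and primes mark
-- those of `x+d`. Adding the two exchange identities eliminates `n`.
shift-Bool : ∀ n a b c a′ b′ c′ z z′ → z ≡ false → z′ ≡ false →
  n xor (a xor b′) ≡ not (b xor a′) → n xor (z xor c′) ≡ not (c xor z′) →
  a′ xor (b′ xor c′) ≡ a xor (b xor c)
shift-Bool = from-yes (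
  all-Bool? λ n → all-Bool? λ a → all-Bool? λ b → all-Bool? λ c → all-Bool? λ a′ →
  all-Bool? λ b′ → all-Bool? λ c′ → all-Bool? λ z → all-Bool? λ z′ →
  (z Bool.≟ false) →-dec (z′ Bool.≟ false) →-dec
  ((n xor (a xor b′)) Bool.≟ not (b xor a′)) →-dec
  ((n xor (z xor c′)) Bool.≟ not (c xor z′)) →-dec
  ((a′ xor (b′ xor c′)) Bool.≟ (a xor (b xor c))))

through-Bool : ∀ a b c d e f → d xor (e xor a) ≡ false → f xor (e xor b) ≡ false →
  f xor (d xor c) ≡ false → a xor (b xor c) ≡ false
through-Bool = from-yes (
  all-Bool? λ a → all-Bool? λ b → all-Bool? λ c → all-Bool? λ d → all-Bool? λ e →
  all-Bool? λ f →
  ((d xor (e xor a)) Bool.≟ false) →-dec ((f xor (e xor b)) Bool.≟ false) →-dec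
  ((f xor (d xor c)) Bool.≟ false) →-dec ((a xor (b xor c)) Bool.≟ false))

exchange-terms-Bool : ∀ n a b c d → a xor b ≡ not (n xor (c xor d)) →
  n xor (a xor b) ≡ not (c xor d)
exchange-terms-Bool = from-yes (
  all-Bool? λ n → all-Bool? λ a → all-Bool? λ b → all-Bool? λ c → all-Bool? λ d →
  ((a xor b) Bool.≟ not (n xor (c xor d))) →-dec ((n xor (a xor b)) Bool.≟ not (c xor d)))

flip-Bool : ∀ n d a b c e → d xor (a xor b) ≡ not (c xor e) →
  (n xor d) xor (c xor e) ≡ not (n xor (a xor b))
flip-Bool = from-yes (
  all-Bool? λ n → all-Bool? λ d → all-Bool? λ a → all-Bool? λ b → all-Bool? λ c →
  all-Bool? λ e →
  ((d xor (a xor b)) Bool.≟ not (c xor e)) →-dec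
  (((n xor d) xor (c xor e)) Bool.≟ not (n xor (a xor b))))

-- Incidence in the Fano plane

module Geometry (FP : FanoPlane) where
  open FanoPlane FP
  module S = Inverse seven
  open ≡ using (refl; sym; trans; cong; cong₂; subst; subst₂; module ≡-Reasoning)

  infix 4 _≟_ _≟ⱽ_ _∈_

  _≟_ : DecidableEquality Point
  _≟_ = _≟P_ FP

  _≟ⱽ_ : DecidableEquality (V FP)
  _≟ⱽ_ = Maybe.≡-dec _≟_

  _∈_ : Point → Fin 7 → Set
  P ∈ i = line i P ≡ true

  _∈?_ : ∀ P i → Dec (P ∈ i)
  P ∈? i = line i P Bool.≟ true

  on≢off : ∀ {P Q i} → P ∈ i → ¬ Q ∈ i → P ≢ Q
  on≢off Pi Q∉i refl = Q∉i Pi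

  line-unique : ∀ {P Q i j} → P ≢ Q → P ∈ i → Q ∈ i → P ∈ j → Q ∈ j → i ≡ j
  line-unique {P} {Q} P≢Q Pi Qi Pj Qj with two-points P Q P≢Q
  ... | _ , _ , unique = trans (sym (unique (Pi , Qi))) (unique (Pj , Qj))

  third-on : ∀ {P Q i} → P ≢ Q → P ∈ i → Q ∈ i →
             ∃[ R ] (R ≢ P × R ≢ Q × R ∈ i × (∀ X → X ∈ i → X ≡ P ⊎ X ≡ Q ⊎ X ≡ R))
  third-on {P} {Q} {i} P≢Q Pi Qi with line-size3 i
  ... | a , b , c , a≢b , a≢c , b≢c , all , ai , bi , ci with all P Pi | all Q Qi
  ... | inj₁ refl        | inj₁ refl        = contradiction refl P≢Q
  ... | inj₁ refl        | inj₂ (inj₁ refl) = c , a≢c ∘ sym , b≢c ∘ sym , ci , all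
  ... | inj₁ refl        | inj₂ (inj₂ refl) = b , a≢b ∘ sym , b≢c , bi , λ X Xi →
    case all X Xi of λ where
      (inj₁ e)        → inj₁ e
      (inj₂ (inj₁ e)) → inj₂ (inj₂ e)
      (inj₂ (inj₂ e)) → inj₂ (inj₁ e)
  ... | inj₂ (inj₁ refl) | inj₁ refl        = c , b≢c ∘ sym , a≢c ∘ sym , ci , λ X Xi →
    case all X Xi of λ where
      (inj₁ e)        → inj₂ (inj₁ e)
      (inj₂ (inj₁ e)) → inj₁ e
      (inj₂ (inj₂ e)) → inj₂ (inj₂ e)
  ... | inj₂ (inj₁ refl) | inj₂ (inj₁ refl) = contradiction refl P≢Q
  ... | inj₂ (inj₁ refl) | inj₂ (inj₂ refl) = a , a≢b , a≢c , ai , λ X Xi →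
    case all X Xi of λ where
      (inj₁ e)        → inj₂ (inj₂ e)
      (inj₂ (inj₁ e)) → inj₁ e
      (inj₂ (inj₂ e)) → inj₂ (inj₁ e)
  ... | inj₂ (inj₂ refl) | inj₁ refl        = b , b≢c , a≢b ∘ sym , bi , λ X Xi →
    case all X Xi of λ where
      (inj₁ e)        → inj₂ (inj₁ e)
      (inj₂ (inj₁ e)) → inj₂ (inj₂ e)
      (inj₂ (inj₂ e)) → inj₁ e
  ... | inj₂ (inj₂ refl) | inj₂ (inj₁ refl) = a , a≢c , a≢b , ai , λ X Xi →
    case all X Xi of λ where
      (inj₁ e)        → inj₂ (inj₂ e)
      (inj₂ (inj₁ e)) → inj₂ (inj₁ e)
      (inj₂ (inj₂ e)) → inj₁ e
  ... | inj₂ (inj₂ refl) | inj₂ (inj₂ refl) = contradiction refl P≢Q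

  abstract
    third : ∀ P Q → P ≢ Q → ∃ (IsSum FP P Q)
    third P Q P≢Q with two-points P Q P≢Q
    ... | i , (Pi , Qi) , _ with third-on P≢Q Pi Qi
    ... | R , R≢P , R≢Q , Ri , _ = R , P≢Q , R≢P , R≢Q , i , Pi , Qi , Ri

  on-line : ∀ {P Q R i} → IsSum FP P Q R → P ∈ i → Q ∈ i →
            ∀ X → X ∈ i → X ≡ P ⊎ X ≡ Q ⊎ X ≡ R
  on-line {R = R} (P≢Q , R≢P , R≢Q , j , Pj , Qj , Rj) Pi Qi
    with refl ← line-unique P≢Q Pi Qi Pj Qj | third-on P≢Q Pi Qi
  ... | T , _ , _ , _ , all with all R Rj
  ... | inj₁ R≡P         = contradiction R≡P R≢P
  ... | inj₂ (inj₁ R≡Q)  = contradiction R≡Q R≢Q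
  ... | inj₂ (inj₂ refl) = all

  sum-on : ∀ {P Q R i} → IsSum FP P Q R → P ∈ i → Q ∈ i → R ∈ i
  sum-on (P≢Q , _ , _ , j , Pj , Qj , Rj) Pi Qi
    with refl ← line-unique P≢Q Pi Qi Pj Qj = Rj

  sum-unique : ∀ {P Q R T} → IsSum FP P Q R → IsSum FP P Q T → R ≡ T
  sum-unique {R = R} s (P≢Q , T≢P , T≢Q , i , Pi , Qi , Ti)
    with on-line s Pi Qi _ Ti
  ... | inj₁ T≡P        = contradiction T≡P T≢P
  ... | inj₂ (inj₁ T≡Q) = contradiction T≡Q T≢Q
  ... | inj₂ (inj₂ T≡R) = sym T≡R

  sum-swap : ∀ {P Q R} → IsSum FP P Q R → IsSum FP Q P R
  sum-swap (P≢Q , R≢P , R≢Q , i , Pi , Qi , Ri) = P≢Q ∘ sym , R≢Q , R≢P , i , Qi , Pi , Ri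

  sum-rotate : ∀ {P Q R} → IsSum FP P Q R → IsSum FP P R Q
  sum-rotate (P≢Q , R≢P , R≢Q , i , Pi , Qi , Ri) =
    R≢P ∘ sym , P≢Q ∘ sym , R≢Q ∘ sym , i , Pi , Ri , Qi

  -- The line through `A` and `B` meets `i` in a point other than `A` and `B`, hence in the third
  -- point. In the cube: a line together with `0` is a subgroup of index two.
  off-line-sum : ∀ {A B R i} → ¬ A ∈ i → ¬ B ∈ i → IsSum FP A B R → R ∈ i
  off-line-sum {A} {B} {R} {i} A∉i B∉i s@(A≢B , _ , _ , j , Aj , Bj , Rj)
    with i Fin.≟ j
  ... | yes refl = contradiction Aj A∉i
  ... | no i≢j with two-lines i j i≢j
  ... | Z , (Zi , Zj) , _ with on-line s Aj Bj Z Zj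
  ... | inj₁ refl        = contradiction Zi A∉i
  ... | inj₂ (inj₁ refl) = contradiction Zi B∉i
  ... | inj₂ (inj₂ refl) = Zi

  another-line : ∀ (i : Fin 7) → ∃[ j ] i ≢ j
  another-line zero    = suc zero , λ ()
  another-line (suc i) = zero , λ ()

  point-off : ∀ i → ∃[ P ] ¬ P ∈ i
  point-off i with another-line i
  ... | j , i≢j with line-size3 j
  ... | a , b , _ , a≢b , _ , _ , _ , aj , bj , _ with a ∈? i | b ∈? i
  ... | no a∉i | _      = a , a∉i
  ... | yes _  | no b∉i = b , b∉i
  ... | yes ai | yes bi = contradiction (line-unique a≢b ai bi aj bj) i≢j

  another-point : ∀ P → ∃[ Q ] P ≢ Q
  another-point P with line-size3 zero
  ... | a , b , _ , a≢b , _ with P ≟ a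
  ... | yes refl = b , a≢b
  ... | no P≢a   = a , P≢a

  -- The Fano cube as an elementary abelian 2-group

  infixl 6 _⊕_

  _⊕_ : V FP → V FP → V FP
  nothing ⊕ y       = y
  just P  ⊕ nothing = just P
  just P  ⊕ just Q with P ≟ Q
  ... | yes _  = nothing
  ... | no P≢Q = just (proj₁ (third P Q P≢Q))

  ⊕-self : ∀ x → x ⊕ x ≡ nothing
  ⊕-self nothing  = refl
  ⊕-self (just P) with P ≟ P
  ... | yes _  = refl
  ... | no P≢P = contradiction refl P≢P

  ⊕-sum : ∀ {P Q R} → IsSum FP P Q R → just P ⊕ just Q ≡ just R
  ⊕-sum {P} {Q} s with P ≟ Q
  ... | yes P≡Q = contradiction P≡Q (proj₁ s)
  ... | no P≢Q  = cong just (sum-unique (proj₂ (third P Q P≢Q)) s)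

  ⊕-identityʳ : ∀ x → x ⊕ nothing ≡ x
  ⊕-identityʳ nothing  = refl
  ⊕-identityʳ (just _) = refl

  ⊕-comm : ∀ x y → x ⊕ y ≡ y ⊕ x
  ⊕-comm nothing  y        = sym (⊕-identityʳ y)
  ⊕-comm (just P) nothing  = refl
  ⊕-comm (just P) (just Q) with P ≟ Q
  ... | yes refl = sym (⊕-self (just P))
  ... | no P≢Q   = sym (⊕-sum (sum-swap (proj₂ (third P Q P≢Q))))

  ⊕-cancel : ∀ x y → x ⊕ (x ⊕ y) ≡ y
  ⊕-cancel nothing  y        = refl
  ⊕-cancel (just P) nothing  = ⊕-self (just P)
  ⊕-cancel (just P) (just Q) with P ≟ Q
  ... | yes refl = refl
  ... | no P≢Q   = ⊕-sum (sum-rotate (proj₂ (third P Q P≢Q)))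

  -- The lines P(Q+R) and (P+Q)R meet, and their common point can only be the third point of each.
  sum-assoc : ∀ {P Q R T U X Y} → P ≢ R → T ≢ R → IsSum FP P Q T → IsSum FP Q R U →
              IsSum FP T R X → IsSum FP P U Y → X ≡ Y
  sum-assoc {P} {Q} {R} {T} {U} {X} {Y} P≢R T≢R
    PQ@(P≢Q , T≢P , T≢Q , k , Pk , Qk , Tk) (Q≢R , U≢Q , U≢R , l , Ql , Rl , Ul)
    TR@(_ , _ , _ , j , Tj , Rj , _) PU@(_ , _ , _ , i , Pi , Ui , _) = common
    where
    R∉k : ¬ R ∈ k
    R∉k Rk with on-line PQ Pk Qk R Rk
    ... | inj₁ e        = P≢R (sym e)
    ... | inj₂ (inj₁ e) = Q≢R (sym e)
    ... | inj₂ (inj₂ e) = T≢R (sym e)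

    j≢k : j ≢ k
    j≢k refl = R∉k Rj

    k≢l : k ≢ l
    k≢l refl = R∉k Rl

    i≢k : i ≢ k
    i≢k refl = k≢l (line-unique U≢Q Ui Qk Ul Ql)

    i≢j : i ≢ j
    i≢j refl = i≢k (line-unique T≢P Tj Pi Tk Pk)

    common : X ≡ Y
    common with two-lines i j i≢j
    ... | Z , (Zi , Zj) , _ with on-line TR Tj Rj Z Zj | on-line PU Pi Ui Z Zi
    ... | inj₁ refl        | _                = contradiction (line-unique T≢P Zi Pi Tk Pk) i≢k
    ... | inj₂ (inj₁ refl) | _                =
      contradiction (line-unique P≢Q Pk Qk (subst (P ∈_) i≡l Pi) Ql) k≢l
      where i≡l = line-unique U≢R Ui Zi Ul Rl
    ... | inj₂ (inj₂ _)    | inj₁ refl        = contradiction (line-unique T≢P Tj Zj Tk Pk) j≢k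
    ... | inj₂ (inj₂ _)    | inj₂ (inj₁ refl) =
      contradiction (line-unique T≢Q Tk Qk (subst (T ∈_) j≡l Tj) Ql) k≢l
      where j≡l = line-unique U≢R Zj Rj Ul Rl
    ... | inj₂ (inj₂ refl) | inj₂ (inj₂ refl) = refl

  ⊕-assoc : ∀ x y z → (x ⊕ y) ⊕ z ≡ x ⊕ (y ⊕ z)
  ⊕-assoc nothing  y        z        = refl
  ⊕-assoc (just P) nothing  z        = refl
  ⊕-assoc (just P) (just Q) nothing  = ⊕-identityʳ _
  ⊕-assoc (just P) (just Q) (just R) = go (P ≟ Q) (Q ≟ R)
    where
    open ≡-Reasoning
    p = just P
    q = just Q
    r = just R

    go : Dec (P ≡ Q) → Dec (Q ≡ R) → (p ⊕ q) ⊕ r ≡ p ⊕ (q ⊕ r)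
    go (yes refl) _ = trans (cong (_⊕ r) (⊕-self p)) (sym (⊕-cancel p r))
    go (no _) (yes refl) = begin
      (p ⊕ q) ⊕ q ≡⟨ ⊕-comm (p ⊕ q) q ⟩
      q ⊕ (p ⊕ q) ≡⟨ cong (q ⊕_) (⊕-comm p q) ⟩
      q ⊕ (q ⊕ p) ≡⟨ ⊕-cancel q p ⟩
      p           ≡⟨ cong (p ⊕_) (⊕-self q) ⟨
      p ⊕ (q ⊕ q) ∎
    go (no P≢Q) (no Q≢R) with third P Q P≢Q | third Q R Q≢R
    ... | T , PQ | U , QR = begin
      (p ⊕ q) ⊕ r ≡⟨ cong (_⊕ r) (⊕-sum PQ) ⟩
      just T ⊕ r  ≡⟨ rest (T ≟ R) (P ≟ R) (P ≟ U) ⟩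
      p ⊕ just U  ≡⟨ cong (p ⊕_) (⊕-sum QR) ⟨
      p ⊕ (q ⊕ r) ∎
      where
      -- `T = R` means that `P`, `Q`, `R` form a line, and then `U = P`; conversely `P = U` forces
      -- `T = R`. If `P = R`, then `T = U`. Outside these degenerate cases `sum-assoc` applies.
      rest : Dec (T ≡ R) → Dec (P ≡ R) → Dec (P ≡ U) → just T ⊕ r ≡ p ⊕ just U
      rest (yes refl) _ _
        with refl ← sum-unique QR (sum-rotate (sum-swap PQ)) = trans (⊕-self r) (sym (⊕-self p))
      rest (no _) (yes refl) _
        with refl ← sum-unique QR (sum-swap PQ) = ⊕-comm (just T) p
      rest (no T≢R) (no _) (yes refl) =
        contradiction (sum-unique PQ (sum-swap (sum-rotate QR))) T≢R
      rest (no T≢R) (no P≢R) (no P≢U) =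
        let X , TR = third T R T≢R
            Y , PU = third P U P≢U
        in begin
        just T ⊕ r ≡⟨ ⊕-sum TR ⟩
        just X     ≡⟨ cong just (sum-assoc P≢R T≢R PQ QR TR PU) ⟩
        just Y     ≡⟨ ⊕-sum PU ⟨
        p ⊕ just U ∎

  ⊕-cancelʳ : ∀ x d → x ⊕ d ⊕ d ≡ x
  ⊕-cancelʳ x d = trans (⊕-assoc x d d) (trans (cong (x ⊕_) (⊕-self d)) (⊕-identityʳ x))

  ⊕-middle : ∀ x d y → x ⊕ d ⊕ (x ⊕ y) ≡ y ⊕ d
  ⊕-middle x d y = trans (cong (_⊕ (x ⊕ y)) (⊕-comm x d)) (trans (⊕-assoc d x (x ⊕ y))
    (trans (cong (d ⊕_) (⊕-cancel x y)) (⊕-comm d y)))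

  eight : V FP ↔ Fin 8
  eight = mk↔ₛ′ to from to-from from-to
    where
    to : V FP → Fin 8
    to nothing  = zero
    to (just P) = suc (S.to P)
    from : Fin 8 → V FP
    from zero    = nothing
    from (suc i) = just (S.from i)
    to-from : ∀ i → to (from i) ≡ i
    to-from zero    = refl
    to-from (suc i) = cong suc (S.strictlyInverseˡ i)
    from-to : ∀ x → from (to x) ≡ x
    from-to nothing  = refl
    from-to (just P) = cong just (S.strictlyInverseʳ P)

  isMinus-sgnBool : ∀ b → isMinus (sgnBool FP b) ≡ b
  isMinus-sgnBool true  = refl
  isMinus-sgnBool false = refl

  sgnBool-isMinus : ∀ s → sgnBool FP (isMinus s) ≡ s
  sgnBool-isMinus Sign.+ = refl
  sgnBool-isMinus Sign.- = refl

  sgnBool-injective : ∀ {a b} → sgnBool FP a ≡ sgnBool FP b → a ≡ b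
  sgnBool-injective {true}  {true}  _ = refl
  sgnBool-injective {false} {false} _ = refl

  sgnBool-plus : ∀ {b} → sgnBool FP b ≡ Sign.+ → b ≡ false
  sgnBool-plus {false} _ = refl

  -- Functionals and their kernels

  any-point? : ∀ {p} {A : Point → Set p} → (∀ P → Dec (A P)) → Dec (∃ A)
  any-point? {A = A} A? = map′ (λ (i , a) → S.from i , a)
    (λ (P , a) → S.to P , subst A (sym (S.strictlyInverseʳ P)) a)
    (Fin.any? (A? ∘ S.from))

  nonzero-point : ∀ (a : Point → Bool) → ¬ (∀ P → a P ≡ false) → ∃[ P ] a P ≡ true
  nonzero-point a a≢0 with any-point? (λ P → a P Bool.≟ true)
  ... | yes found = found
  ... | no none   = contradiction (λ P → Bool.¬-not (none ∘ (P ,_))) a≢0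

  zero-on-line : ∀ (a : Dual FP) {P Q i} → P ≢ Q → P ∈ i → Q ∈ i →
                 proj₁ a P ≡ false → proj₁ a Q ≡ false → ∀ X → X ∈ i → proj₁ a X ≡ false
  zero-on-line (a , lin) {P} {Q} P≢Q Pi Qi aP aQ X Xi with third P Q P≢Q
  ... | R , PQ with on-line PQ Pi Qi X Xi
  ... | inj₁ refl        = aP
  ... | inj₂ (inj₁ refl) = aQ
  ... | inj₂ (inj₂ refl) = trans (lin P Q X PQ) (cong₂ _xor_ aP aQ)

  -- A line and one point `E` off it generate the cube: for any other `X` off the line, `X+E` lies
  -- on the line.
  zero-off-line : ∀ (a : Dual FP) {i E} → (∀ X → X ∈ i → proj₁ a X ≡ false) →
                  ¬ E ∈ i → proj₁ a E ≡ false → ∀ X → proj₁ a X ≡ false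
  zero-off-line (a , lin) {i} {E} on aE₀ aE X with X ∈? i | X ≟ E
  ... | yes Xi | _        = on X Xi
  ... | no _   | yes refl = aE
  ... | no X∉i | no X≢E with third X E X≢E
  ... | Z , XE = begin
    a X           ≡⟨ Bool.xor-identityʳ (a X) ⟨
    a X xor false ≡⟨ cong (a X xor_) aE ⟨
    a X xor a E   ≡⟨ lin X E Z XE ⟨
    a Z           ≡⟨ on Z (off-line-sum X∉i aE₀ XE) ⟩
    false         ∎
    where open ≡-Reasoning

  -- Since `a` is `1` at `P`, it takes different values at `Q` and `P+Q`.
  kernel-point : ∀ (a : Dual FP) {P} Q → proj₁ a P ≡ true → P ≢ Q →
                 ∃[ K ] (proj₁ a K ≡ false × (K ≡ Q ⊎ IsSum FP P Q K))
  kernel-point (a , lin) {P} Q aP P≢Q with a Q in aQ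
  ... | false = Q , aQ , inj₁ refl
  ... | true with third P Q P≢Q
  ... | K , PQ = K , trans (lin P Q K PQ) (cong₂ _xor_ aP aQ) , inj₂ PQ

  -- Kernel points `K` and `L` on two different lines through `P` are distinct and span a line
  -- inside the kernel. The kernel is no larger: a kernel point off that line, added to `P`, would
  -- give a point of the line with value `1`.
  kernel-line : ∀ (a : Dual FP) {P} → proj₁ a P ≡ true →
                ∃[ i ] (∀ Q → (proj₁ a Q ≡ false → Q ∈ i) × (Q ∈ i → proj₁ a Q ≡ false))
  kernel-line a@(α , lin) {P} aP =
    let Q , P≢Q           = another-point P
        K , aK , _        = kernel-point a Q aP P≢Q
        j , (Pj , Kj) , _ = two-points P K (separate aP aK)
        R , R∉j           = point-off j
        L , aL , L-or     = kernel-point a R aP (on≢off Pj R∉j)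
        K≢L               = on≢off Kj (L∉j Pj R∉j L-or)
        i , (Ki , Li) , _ = two-points K L K≢L
        on                = zero-on-line a K≢L Ki Li aK aL
    in i , λ X → in-line on X , on X
    where
    separate : ∀ {X Y} → α X ≡ true → α Y ≡ false → X ≢ Y
    separate aX aY refl = contradiction (trans (sym aX) aY) λ ()

    L∉j : ∀ {L R j} → P ∈ j → ¬ R ∈ j → L ≡ R ⊎ IsSum FP P R L → ¬ L ∈ j
    L∉j Pj R∉j (inj₁ refl) Lj = R∉j Lj
    L∉j Pj R∉j (inj₂ PR)   Lj = R∉j (sum-on (sum-rotate PR) Pj Lj)

    in-line : ∀ {i} → (∀ X → X ∈ i → α X ≡ false) → ∀ X → α X ≡ false → X ∈ i
    in-line {i} on X aX with X ∈? i
    ... | yes Xi = Xi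
    ... | no X∉i =
      let Z , XP = third X P (separate aP aX ∘ sym)
          aZ     = trans (lin X P Z XP) (cong₂ _xor_ aX aP)
          Zi     = off-line-sum X∉i (λ Pi → separate aP (on P Pi) refl) XP
      in contradiction refl (separate aZ (on Z Zi))

  -- This is the functional with kernel `i`. Two points off `i` have their sum on `i` by
  -- `off-line-sum`; in the other cases two points on `i` would force the third onto it.
  complement-linear : ∀ i → IsLinear FP (not ∘ line i)
  complement-linear i P Q R PQ with P ∈? i | Q ∈? i
  ... | yes Pi | yes Qi rewrite Pi | Qi | sum-on PQ Pi Qi = refl
  ... | yes Pi | no Q∉i rewrite Pi | Bool.¬-not Q∉i
                              | Bool.¬-not (Q∉i ∘ sum-on (sum-rotate PQ) Pi) = refl
  ... | no P∉i | yes Qi rewrite Qi | Bool.¬-not P∉i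
                              | Bool.¬-not (P∉i ∘ sum-on (sum-rotate (sum-swap PQ)) Qi) = refl
  ... | no P∉i | no Q∉i rewrite Bool.¬-not P∉i | Bool.¬-not Q∉i
                              | off-line-sum P∉i Q∉i PQ = refl

  ⟦_⟧ : Dual FP → V FP → Bool
  ⟦ n ⟧ nothing  = false
  ⟦ n ⟧ (just P) = proj₁ n P

  ⟦⟧-⊕ : ∀ n x y → ⟦ n ⟧ (x ⊕ y) ≡ ⟦ n ⟧ x xor ⟦ n ⟧ y
  ⟦⟧-⊕ n nothing  y        = refl
  ⟦⟧-⊕ n (just P) nothing  = sym (Bool.xor-identityʳ _)
  ⟦⟧-⊕ n (just P) (just Q) with P ≟ Q
  ... | yes refl = sym (Bool.xor-same (proj₁ n P))
  ... | no P≢Q   = proj₂ n P Q _ (proj₂ (third P Q P≢Q))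

  -- Multiplication factors and the exponent `F`

  opp : MultFun FP → MultFun FP
  opp ε P Q = Sign.opposite (ε P Q)

  opp-factor : ∀ {ε} → IsMultFactor FP ε → IsMultFactor FP (opp ε)
  opp-factor anti P Q P≢Q = cong Sign.opposite (anti P Q P≢Q)

  -- e_x e_y = (-1)^(exponent x y) e_(x+y) on the whole cube, including
  -- e_0 and the diagonal.
  exponent : Dual FP → MultFun FP → V FP → V FP → Bool
  exponent n ε nothing  _        = false
  exponent n ε (just _) nothing  = false
  exponent n ε (just P) (just Q) with P ≟ Q
  ... | yes _ = not (proj₁ n P)
  ... | no _  = isMinus (ε P Q)

  module _ (n : Dual FP) (ε : MultFun FP) where

    exponent-zeroʳ : ∀ x → exponent n ε x nothing ≡ false
    exponent-zeroʳ nothing  = refl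
    exponent-zeroʳ (just _) = refl

    exponent-diagonal : ∀ P → exponent n ε (just P) (just P) ≡ not (proj₁ n P)
    exponent-diagonal P with P ≟ P
    ... | yes _  = refl
    ... | no P≢P = contradiction refl P≢P

    exponent-distinct : ∀ {P Q} → P ≢ Q → exponent n ε (just P) (just Q) ≡ isMinus (ε P Q)
    exponent-distinct {P} {Q} P≢Q with P ≟ Q
    ... | yes P≡Q = contradiction P≡Q P≢Q
    ... | no _    = refl

  -- Off the diagonal `-ε_PQ = ε_QP`, while squares and products with `e_0` do not involve `ε`.
  -- Hence the algebra of `-ε` is the opposite of the algebra of `ε`.
  exponent-opp : ∀ n {ε} → IsMultFactor FP ε →
                 ∀ x y → exponent n (opp ε) x y ≡ exponent n ε y x
  exponent-opp n anti nothing  y        = sym (exponent-zeroʳ n _ y)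
  exponent-opp n anti (just P) nothing  = refl
  exponent-opp n {ε} anti (just P) (just Q) = case P ≟ Q of λ where
      (yes refl) → trans (exponent-diagonal n (opp ε) P) (sym (exponent-diagonal n ε P))
      (no P≢Q)   → begin
        exponent n (opp ε) (just P) (just Q) ≡⟨ exponent-distinct n (opp ε) P≢Q ⟩
        isMinus (opp ε P Q)                  ≡⟨ cong isMinus (anti P Q P≢Q) ⟨
        isMinus (ε Q P)                      ≡⟨ exponent-distinct n ε (P≢Q ∘ sym) ⟨
        exponent n ε (just Q) (just P)       ∎
    where open ≡-Reasoning

  Additive : MultFun FP → Dual FP → Set
  Additive ε n = ∀ x y z → exponent n ε x (y ⊕ z) ≡ exponent n ε x y xor exponent n ε x z

  -- The coefficients of z_x z_(x+d) w_y w_(y+d) in N(ZW) cancel.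
  Exchange : Dual FP → MultFun FP → Set
  Exchange n ε = ∀ d x y → d ≢ nothing →
    ⟦ n ⟧ d xor (F x y xor F (x ⊕ d) (y ⊕ d)) ≡ not (F x (y ⊕ d) xor F (x ⊕ d) y)
    where F = exponent n ε

  exchange-opp : ∀ n {ε} → IsMultFactor FP ε → Exchange n ε → Exchange n (opp ε)
  exchange-opp n {ε} anti ex d x y d≢0
    rewrite exponent-opp n anti x y | exponent-opp n anti (x ⊕ d) (y ⊕ d)
          | exponent-opp n anti x (y ⊕ d) | exponent-opp n anti (x ⊕ d) y
    = trans (ex d y x d≢0) (cong not (Bool.xor-comm (exponent n ε y (x ⊕ d)) _))

  -- From oriented maps to the exchange identity and the futures

  module Orientation (n : Dual FP) (or : Oriented FP n) where

    α : Point → Dual FP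
    α = proj₁ or

    α-self : ∀ P → proj₁ (α P) P ≡ not (proj₁ n P)
    α-self P = xor-true (proj₁ (proj₂ or) P)

    α-swap : ∀ {P Q} → P ≢ Q → proj₁ (α P) Q ≡ not (proj₁ (α Q) P)
    α-swap P≢Q = xor-true (proj₂ (proj₂ or) _ _ P≢Q)

    factor : IsMultFactor FP (eOf FP α)
    factor P Q P≢Q rewrite α-swap P≢Q with proj₁ (α Q) P
    ... | true  = refl
    ... | false = refl

    F : V FP → V FP → Bool
    F = exponent n (eOf FP α)

    exponent-oriented : ∀ P y → F (just P) y ≡ ⟦ α P ⟧ y
    exponent-oriented P nothing  = refl
    exponent-oriented P (just Q) = case P ≟ Q of λ where
      (yes refl) → trans (exponent-diagonal n (eOf FP α) P) (sym (α-self P))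
      (no P≢Q)   → trans (exponent-distinct n (eOf FP α) P≢Q) (isMinus-sgnBool _)

    additive : Additive (eOf FP α) n
    additive nothing  y z = refl
    additive (just P) y z
      rewrite exponent-oriented P (y ⊕ z) | exponent-oriented P y | exponent-oriented P z
      = ⟦⟧-⊕ (α P) y z

    -- This is the exchange identity at `y = 0`, to which additivity reduces the general one. For
    -- distinct points `P` and `D` with `R = P+D`, antisymmetry turns `α_R(D)` and `α_P(D)` into
    -- `α_D(R)` and `α_D(P)`, whose sum is `α_D(D) = 1 + n(D)`.
    column-step : ∀ D x → proj₁ n D xor F (x ⊕ just D) (just D) ≡ not (F x (just D))
    column-step D nothing
      rewrite exponent-diagonal n (eOf FP α) D = Bool.xor-inverseʳ (proj₁ n D)
    column-step D (just P) = case P ≟ D of λ where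
        (yes refl) → begin
          proj₁ n D xor F (just D ⊕ just D) (just D) ≡⟨ cong (λ x → proj₁ n D xor F x (just D)) (⊕-self (just D)) ⟩
          proj₁ n D xor false                        ≡⟨ Bool.xor-identityʳ _ ⟩
          proj₁ n D                                  ≡⟨ Bool.not-involutive _ ⟨
          not (not (proj₁ n D))                      ≡⟨ cong not (exponent-diagonal n (eOf FP α) D) ⟨
          not (F (just D) (just D))                  ∎
        (no P≢D) → let R , PD = third P D P≢D in begin
          proj₁ n D xor F (just P ⊕ just D) (just D) ≡⟨ cong (λ x → proj₁ n D xor F x (just D)) (⊕-sum PD) ⟩
          proj₁ n D xor F (just R) (just D)          ≡⟨ cong (proj₁ n D xor_) (exponent-oriented R (just D)) ⟩
          proj₁ n D xor proj₁ (α R) D                ≡⟨ column-Bool (proj₁ n D) (proj₁ (α R) D) (proj₁ (α P) D)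
                                                          (proj₁ (α D) P) (proj₁ (α D) R) (proj₁ (α D) D)
                                                          (α-self D) (α-swap (proj₁ (proj₂ (proj₂ PD))))
                                                          (α-swap P≢D) (proj₂ (α D) P R D (sum-rotate PD)) ⟩
          not (proj₁ (α P) D)                        ≡⟨ cong not (exponent-oriented P (just D)) ⟨
          not (F (just P) (just D))                  ∎
      where open ≡-Reasoning

    exchange : Exchange n (eOf FP α)
    exchange nothing  x y d≢0 = contradiction refl d≢0
    exchange (just D) x y _
      rewrite additive x y (just D) | additive (x ⊕ just D) y (just D)
      = exchange-Bool (proj₁ n D) (F x y) (F (x ⊕ just D) y) (F (x ⊕ just D) (just D)) (F x (just D))
          (column-step D x)

    -- Here `α_P(P) = 1`, so `α_P` is nonzero and its kernel is a line avoiding `P`; the kernel is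
    -- the future of `P`.
    future-line : IsZeroDual FP n → ∀ P → IsLineSet FP (InFuture FP (eOf FP α) P)
    future-line n≡0 P =
      let i , kernel = kernel-line (α P) (trans (α-self P) (cong not (n≡0 P)))
      in i , λ Q → (λ (_ , plus) → proj₁ (kernel Q) (sgnBool-plus plus))
                 , λ Qi → (λ { refl → contradiction
                             (trans (sym (cong not (n≡0 P))) (trans (sym (α-self P)) (proj₂ (kernel Q) Qi))) λ () })
                        , cong (sgnBool FP) (proj₂ (kernel Q) Qi)

    -- Start from n(A) = 1, so that α_A(A) = 0, and α_A(B) = 1, n(B) = 0. For
    -- C = A + B the functional α_C vanishes on the line ABC. Let E be a point off
    -- this line with n(E) = α_A(E) = 1. Either α_C(E) = 0 and then α_C = 0, or
    -- α_E vanishes at A, C and E.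
    zero-point : ¬ IsZeroDual FP n → ∃[ P ] (∀ Q → proj₁ (α P) Q ≡ false)
    zero-point n≢0 with nonzero-point (proj₁ n) n≢0
    ... | A , nA with any-point? (λ B → proj₁ (α A) B Bool.≟ true)
    ... | no none = A , λ Q → Bool.¬-not (none ∘ (Q ,_))
    ... | yes (B₀ , aB₀) = from-B (adjust B₀ aB₀)
      where
      a : Point → Bool
      a = proj₁ (α A)

      aA : a A ≡ false
      aA = trans (α-self A) (cong not nA)

      A≢ : ∀ {X} → a X ≡ true → A ≢ X
      A≢ aX refl = contradiction (trans (sym aA) aX) λ ()

      -- Adding `A` flips `n`, because `n A = 1`, and keeps `a`, because `a A = 0`.
      adjust : ∀ B → a B ≡ true → ∃[ B ] (a B ≡ true × proj₁ n B ≡ false)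
      adjust B aB with proj₁ n B in nB
      ... | false = B , aB , nB
      ... | true  = let C , AB = third A B (A≢ aB) in
        C , trans (proj₂ (α A) A B C AB) (cong₂ _xor_ aA aB)
          , trans (proj₂ n A B C AB) (cong₂ _xor_ nA nB)

      from-B : ∃[ B ] (a B ≡ true × proj₁ n B ≡ false) → ∃[ P ] (∀ Q → proj₁ (α P) Q ≡ false)
      from-B (B , aB , nB) with third A B (A≢ aB)
      ... | C , AB@(A≢B , C≢A , C≢B , i , Ai , Bi , Ci) = from-E (adjust₂ (adjust₁ (point-off i)))
        where
        nC : proj₁ n C ≡ true
        nC = trans (proj₂ n A B C AB) (cong₂ _xor_ nA nB)

        aC : a C ≡ true
        aC = trans (proj₂ (α A) A B C AB) (cong₂ _xor_ aA aB)

        αC-on-line : ∀ X → X ∈ i → proj₁ (α C) X ≡ false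
        αC-on-line = zero-on-line (α C) C≢A Ci Ai
          (trans (α-self C) (cong not nC)) (trans (α-swap C≢A) (cong not aC))

        off : ∀ {P X Z} → P ∈ i → ¬ X ∈ i → IsSum FP P X Z → ¬ Z ∈ i
        off Pi X∉i PX Zi = X∉i (sum-on (sum-rotate PX) Pi Zi)

        -- Adding `A` flips `n`; in `adjust₂`, adding `B` flips `a` and keeps `n`, because
        -- `n B = 0`. As `A` and `B` lie on `i`, neither moves a point onto `i`.
        adjust₁ : ∃[ X ] (¬ X ∈ i) → ∃[ X ] (¬ X ∈ i × proj₁ n X ≡ true)
        adjust₁ (X , X∉i) with proj₁ n X in nX
        ... | true  = X , X∉i , nX
        ... | false = let Z , AX = third A X (on≢off Ai X∉i) in
          Z , off Ai X∉i AX , trans (proj₂ n A X Z AX) (cong₂ _xor_ nA nX)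

        adjust₂ : ∃[ X ] (¬ X ∈ i × proj₁ n X ≡ true) →
                  ∃[ X ] (¬ X ∈ i × proj₁ n X ≡ true × a X ≡ true)
        adjust₂ (X , X∉i , nX) with a X in aX
        ... | true  = X , X∉i , nX , aX
        ... | false = let Z , BX = third B X (on≢off Bi X∉i) in
          Z , off Bi X∉i BX , trans (proj₂ n B X Z BX) (cong₂ _xor_ nB nX)
            , trans (proj₂ (α A) B X Z BX) (cong₂ _xor_ aB aX)

        from-E : ∃[ E ] (¬ E ∈ i × proj₁ n E ≡ true × a E ≡ true) →
                 ∃[ P ] (∀ Q → proj₁ (α P) Q ≡ false)
        from-E (E , E∉i , nE , aE) with proj₁ (α C) E in cE
        ... | false = C , zero-off-line (α C) αC-on-line E∉i cE
        ... | true  = E , zero-off-line (α E)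
          (zero-on-line (α E) C≢A Ci Ai
            (trans (α-swap (on≢off Ci E∉i ∘ sym)) (cong not cE))
            (trans (α-swap (on≢off Ai E∉i ∘ sym)) (cong not aE)))
          E∉i (trans (α-self E) (cong not nE))

    source : ¬ IsZeroDual FP n → ∃! _≡_ (λ P → IsAllBut FP P (InFuture FP (eOf FP α) P))
    source n≢0 =
      let P , αP≡0 = zero-point n≢0
      in P , (λ Q → proj₁ , λ Q≢P → Q≢P , cong (sgnBool FP) (αP≡0 Q))
           , λ {Q} all → unique P Q αP≡0 all
      where
      unique : ∀ P Q → (∀ X → proj₁ (α P) X ≡ false) →
               IsAllBut FP Q (InFuture FP (eOf FP α) Q) → P ≡ Q
      unique P Q αP≡0 all with P ≟ Q
      ... | yes P≡Q = P≡Q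
      ... | no P≢Q  = contradiction
        (trans (sym (αP≡0 Q)) (trans (α-swap P≢Q)
          (cong not (sgnBool-plus (proj₂ (proj₂ (all P) P≢Q)))))) λ ()

  -- Additivity forced by a source

  module Source (n : Dual FP) (ε : MultFun FP) (exchange : Exchange n ε)
                (S : Point) (future : IsAllBut FP S (InFuture FP ε S)) where
    open ≡-Reasoning

    F : V FP → V FP → Bool
    F = exponent n ε

    s : V FP
    s = just S

    defect : V FP → V FP → V FP → Bool
    defect x y d = F x y xor (F x (y ⊕ d) xor F x d)

    defect-comm : ∀ x y d → defect x y d ≡ defect x d y
    defect-comm x y d rewrite ⊕-comm y d = reverse-Bool (F x y) (F x (d ⊕ y)) (F x d)

    defect-rotate : ∀ x y d → defect x y d ≡ defect x y (y ⊕ d)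
    defect-rotate x y d rewrite ⊕-cancel y d = cong (F x y xor_) (Bool.xor-comm (F x (y ⊕ d)) (F x d))

    -- The exchange identity at (x, y), compared with the one at (x, 0).
    defect-shift : ∀ x y d → defect (x ⊕ d) y d ≡ defect x y d
    defect-shift x y nothing  = cong (λ x → defect x y nothing) (⊕-identityʳ x)
    defect-shift x y (just D) =
      shift-Bool (proj₁ n D) (F x y) (F x (y ⊕ just D)) (F x (just D))
        (F (x ⊕ just D) y) (F (x ⊕ just D) (y ⊕ just D)) (F (x ⊕ just D) (just D))
        (F x nothing) (F (x ⊕ just D) nothing)
        (exponent-zeroʳ n ε x) (exponent-zeroʳ n ε (x ⊕ just D))
        (exchange (just D) x y (λ ())) (exchange (just D) x nothing (λ ()))

    defect-shiftˡ : ∀ x y d → defect (x ⊕ y) y d ≡ defect x y d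
    defect-shiftˡ x y d = begin
      defect (x ⊕ y) y d ≡⟨ defect-comm (x ⊕ y) y d ⟩
      defect (x ⊕ y) d y ≡⟨ defect-shift x d y ⟩
      defect x d y       ≡⟨ defect-comm x d y ⟩
      defect x y d       ∎

    defect-shift-sum : ∀ x y d → defect (x ⊕ (y ⊕ d)) y d ≡ defect x y d
    defect-shift-sum x y d = begin
      defect (x ⊕ (y ⊕ d)) y d ≡⟨ cong (λ x → defect x y d) (⊕-assoc x y d) ⟨
      defect (x ⊕ y ⊕ d) y d   ≡⟨ defect-shift (x ⊕ y) y d ⟩
      defect (x ⊕ y) y d       ≡⟨ defect-shiftˡ x y d ⟩
      defect x y d             ∎

    -- Only `F s s` is not given directly. On a line `s`, `R`, `s+R` the defect at `s` equals the
    -- defect at `0`, which vanishes; its terms at `R` and `s+R` are zero, hence so is `F s s`. In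
    -- other words, `n S = 1`.
    F-source : ∀ y → F s y ≡ false
    F-source nothing  = refl
    F-source (just Q) = case S ≟ Q of λ where
        (yes refl) →
          let R , S≢R = another-point S
              T , SR  = third S R S≢R
          in subst₂ (λ u v → (F s s xor (u xor v)) ≡ false → F s s ≡ false)
               (sym (trans (cong (F s) (⊕-sum SR)) (off (proj₁ (proj₂ SR) ∘ sym)))) (sym (off S≢R))
               (trans (sym (Bool.xor-identityʳ (F s s))))
               (defect-shiftˡ nothing s (just R))
        (no S≢Q) → off S≢Q
      where
      off : ∀ {Q} → S ≢ Q → F s (just Q) ≡ false
      off {Q} S≢Q = trans (exponent-distinct n ε S≢Q)
        (cong isMinus (proj₂ (proj₂ (future Q) (S≢Q ∘ sym))))

    defect-source : ∀ y d → defect s y d ≡ false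
    defect-source y d rewrite F-source y | F-source (y ⊕ d) | F-source d = refl

    -- The sum of the vanishing defects of x on the lines {x+s, y, x+y+s},
    -- {x, y+s, x+y+s} and {x, s, x+s}.
    defect-through-source : ∀ x y → defect x y s ≡ false
    defect-through-source x y =
      through-Bool (F x y) (F x (y ⊕ s)) (F x s) (F x (x ⊕ s)) (F x (x ⊕ s ⊕ y)) (F x x)
        (trans (sym (cong (λ z → defect z (x ⊕ s) y) (s⊕[x⊕s]≡x)))
          (trans (defect-shiftˡ s (x ⊕ s) y) (defect-source (x ⊕ s) y)))
        (trans (cong (λ z → F x x xor (F x z xor F x (y ⊕ s))) x⊕s⊕y≡x⊕[y⊕s])
          (defect-shiftˡ nothing x (y ⊕ s)))
        (defect-shiftˡ nothing x s)
      where
      s⊕[x⊕s]≡x : s ⊕ (x ⊕ s) ≡ x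
      s⊕[x⊕s]≡x = trans (cong (s ⊕_) (⊕-comm x s)) (⊕-cancel s x)

      x⊕s⊕y≡x⊕[y⊕s] : x ⊕ s ⊕ y ≡ x ⊕ (y ⊕ s)
      x⊕s⊕y≡x⊕[y⊕s] = trans (⊕-assoc x s y) (cong (x ⊕_) (⊕-comm s y))

    -- If the line misses `S`, then `0` and `s` represent its two cosets: `S+X` lies on the line for
    -- every `X ≠ S` off it. If it contains `S`, the symmetry of the defect in the three points of
    -- the line brings `S` into the last argument.
    defect-on-line : ∀ {Q D R i} → IsSum FP Q D R → Q ∈ i → D ∈ i →
                     ∀ x → defect x (just Q) (just D) ≡ false
    defect-on-line {Q} {D} {R} {i} QD Qi Di x with S ∈? i
    defect-on-line {Q} {D} {R} {i} QD Qi Di x | yes Si with on-line QD Qi Di S Si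
    ... | inj₁ refl        = trans (defect-comm x s (just D)) (defect-through-source x (just D))
    ... | inj₂ (inj₁ refl) = defect-through-source x (just Q)
    ... | inj₂ (inj₂ refl) = begin
      defect x (just Q) (just D)            ≡⟨ defect-rotate x (just Q) (just D) ⟩
      defect x (just Q) (just Q ⊕ just D)   ≡⟨ cong (defect x (just Q)) (⊕-sum QD) ⟩
      defect x (just Q) s                   ≡⟨ defect-through-source x (just Q) ⟩
      false                                 ∎
    defect-on-line {Q} {D} {R} {i} QD Qi Di x | no S∉i = at x
      where
      shift : ∀ {Z} → Z ∈ i → ∀ x → defect (x ⊕ just Z) (just Q) (just D) ≡ defect x (just Q) (just D)
      shift {Z} Zi x with on-line QD Qi Di Z Zi
      ... | inj₁ refl        = defect-shiftˡ x (just Q) (just D)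
      ... | inj₂ (inj₁ refl) = defect-shift x (just Q) (just D)
      ... | inj₂ (inj₂ refl) = subst (λ z → defect (x ⊕ z) (just Q) (just D) ≡ defect x (just Q) (just D))
                                 (⊕-sum QD) (defect-shift-sum x (just Q) (just D))

      at : ∀ x → defect x (just Q) (just D) ≡ false
      at nothing = refl
      at (just X) with X ∈? i | S ≟ X
      ... | yes Xi | _        = shift Xi nothing
      ... | no _   | yes refl = defect-source (just Q) (just D)
      ... | no X∉i | no S≢X =
        let Z , SX = third S X S≢X in begin
        defect (just X) (just Q) (just D)     ≡⟨ cong (λ x → defect x (just Q) (just D)) (⊕-sum (sum-rotate SX)) ⟨
        defect (s ⊕ just Z) (just Q) (just D) ≡⟨ shift (off-line-sum S∉i X∉i SX) s ⟩
        defect s (just Q) (just D)            ≡⟨ defect-source (just Q) (just D) ⟩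
        false                                 ∎

    defect-zero : ∀ x y d → defect x y d ≡ false
    defect-zero x nothing d
      rewrite exponent-zeroʳ n ε x = Bool.xor-same (F x d)
    defect-zero x (just Q) nothing
      rewrite exponent-zeroʳ n ε x | Bool.xor-identityʳ (F x (just Q)) = Bool.xor-same (F x (just Q))
    defect-zero x (just Q) (just D) = case Q ≟ D of λ where
      (yes refl) → trans (cong (λ z → F x (just Q) xor (F x z xor F x (just Q))) (⊕-self (just Q)))
                     (trans (cong (λ b → F x (just Q) xor (b xor F x (just Q))) (exponent-zeroʳ n ε x))
                       (Bool.xor-same (F x (just Q))))
      (no Q≢D) →
        let R , QD@(_ , _ , _ , _ , Qi , Di , _) = third Q D Q≢D in defect-on-line QD Qi Di x

    additive : Additive ε n
    additive x y z = solve-defect-Bool (F x y) (F x (y ⊕ z)) (F x z) (defect-zero x y z)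

  -- Recovering oriented maps from multiplication factors

  lines-additive : ∀ n ε → IsZeroDual FP n →
                   (∀ P → IsLineSet FP (InFuture FP ε P)) → Additive ε n
  lines-additive n ε n≡0 lines nothing  y z = refl
  lines-additive n ε n≡0 lines (just P) y z with lines P
  ... | i , future = begin
    exponent n ε (just P) (y ⊕ z)                         ≡⟨ exponent-line (y ⊕ z) ⟩
    ⟦ off-i ⟧ (y ⊕ z)                                     ≡⟨ ⟦⟧-⊕ off-i y z ⟩
    ⟦ off-i ⟧ y xor ⟦ off-i ⟧ z                           ≡⟨ cong₂ _xor_ (exponent-line y) (exponent-line z) ⟨
    exponent n ε (just P) y xor exponent n ε (just P) z   ∎
    where
    open ≡-Reasoning

    off-i : Dual FP
    off-i = not ∘ line i , complement-linear i

    off-diagonal : ∀ {Q} → P ≢ Q → isMinus (ε P Q) ≡ not (line i Q)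
    off-diagonal {Q} P≢Q with ε P Q in εPQ | line i Q in Qi
    ... | Sign.+ | true  = refl
    ... | Sign.- | false = refl
    ... | Sign.+ | false = contradiction
      (trans (sym Qi) (proj₁ (future Q) (P≢Q ∘ sym , εPQ))) λ ()
    ... | Sign.- | true  = contradiction
      (trans (sym εPQ) (proj₂ (proj₂ (future Q) Qi))) λ ()

    exponent-line : ∀ y → exponent n ε (just P) y ≡ ⟦ off-i ⟧ y
    exponent-line nothing  = refl
    exponent-line (just Q) = case P ≟ Q of λ where
      -- `P` is not in its own future, so it lies off `i`; both sides are `1` because `n P = 0`.
      (yes refl) → trans (exponent-diagonal n ε P)
        (cong not (trans (n≡0 P) (sym (Bool.¬-not (λ Pi → proj₁ (proj₂ (future P) Pi) refl)))))
      (no P≢Q) → trans (exponent-distinct n ε P≢Q) (off-diagonal P≢Q)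

  orient : ∀ n ε → IsMultFactor FP ε → Additive ε n → Oriented FP n
  orient n ε anti additive = α , diagonal , distinct
    where
    α : Point → Dual FP
    α P = exponent n ε (just P) ∘ just , λ Q R T QR →
      trans (cong (exponent n ε (just P)) (sym (⊕-sum QR))) (additive (just P) (just Q) (just R))

    diagonal : ∀ P → proj₁ (α P) P xor proj₁ n P ≡ true
    diagonal P rewrite exponent-diagonal n ε P = Bool.xor-inverseˡ (proj₁ n P)

    distinct : ∀ P Q → P ≢ Q → proj₁ (α P) Q xor proj₁ (α Q) P ≡ true
    distinct P Q P≢Q
      rewrite exponent-distinct n ε P≢Q | exponent-distinct n ε (P≢Q ∘ sym) | anti P Q P≢Q
      with ε P Q
    ... | Sign.+ = refl
    ... | Sign.- = refl

  orient-factor : ∀ n ε anti additive → _≐_ FP ε (eOf FP (proj₁ (orient n ε anti additive)))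
  orient-factor n ε anti additive P Q P≢Q
    rewrite exponent-distinct n ε P≢Q = sym (sgnBool-isMinus (ε P Q))

  -- The signs determine `α_P(Q)` for `P ≠ Q`; on the diagonal both maps have the value `1 + n(P)`.
  oriented-unique : ∀ n (α β : Oriented FP n) → _≐_ FP (eOf FP (proj₁ α)) (eOf FP (proj₁ β)) →
                    _≗α_ FP (proj₁ α) (proj₁ β)
  oriented-unique n α β α≐β P Q = case P ≟ Q of λ where
    (yes refl) → trans (Orientation.α-self n α P) (sym (Orientation.α-self n β P))
    (no P≢Q)   → sgnBool-injective (α≐β P Q P≢Q)

  IsLineSet-map : ∀ {A B : Point → Set} → (∀ {Q} → A Q → B Q) → (∀ {Q} → B Q → A Q) →
                  IsLineSet FP A → IsLineSet FP B
  IsLineSet-map f g (i , A⇔i) = i , λ Q → proj₁ (A⇔i Q) ∘ g , f ∘ proj₂ (A⇔i Q)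

  source-map : ∀ {A B : Point → Point → Set} →
                 (∀ {P Q} → A P Q → B P Q) → (∀ {P Q} → B P Q → A P Q) →
                 ∃! _≡_ (λ P → IsAllBut FP P (A P)) → ∃! _≡_ (λ P → IsAllBut FP P (B P))
  source-map f g (P , all , unique) =
    P , (λ Q → proj₁ (all Q) ∘ g , f ∘ proj₂ (all Q)) ,
    λ all′ → unique (λ Q → proj₁ (all′ Q) ∘ f , g ∘ proj₂ (all′ Q))

-- Sums over a finite type, for the seven points and for the eight elements of the cube

module FiniteSum {c ℓ} (K : Field c ℓ) {A : Set} {k : ℕ} (enumeration : A ↔ Fin (suc k)) where
  open Field K
  open Algebra.Properties.Semiring.Sum semiring
    using (sum; sum-cong-≋; sum-remove; sum-replicate-zero; *-distribˡ-sum; *-distribʳ-sum; ∑-comm; sum-permute)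
  open Inverse enumeration
  open Relation.Binary.Reasoning.Setoid setoid

  abstract
    ∑ : (A → Carrier) → Carrier
    ∑ f = sum (λ i → f (from i))

    ∑-def : ∀ f → ∑ f ≡ sum (λ i → f (from i))
    ∑-def f = ≡.refl

    ∑-cong : ∀ {f g} → (∀ x → f x ≈ g x) → ∑ f ≈ ∑ g
    ∑-cong f≈g = sum-cong-≋ (λ i → f≈g (from i))

    ∑-zero : ∀ {f} → (∀ x → f x ≈ 0#) → ∑ f ≈ 0#
    ∑-zero f≈0 = trans (∑-cong f≈0) (sum-replicate-zero (suc k))

    -- The remainder stays a sum over all of `A`, with a zero at `x`. So the splitting can be
    -- repeated, as in `∑-pair`, and fits a summand that vanishes at `x` by itself.
    ∑-isolate : ∀ f g x → f x ≈ 0# → (∀ y → y ≢ x → f y ≈ g y) → ∑ g ≈ g x + ∑ f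
    ∑-isolate f g x fx≈0 f≈g = begin
      ∑ g                            ≈⟨ sum-remove {i = to x} (g ∘ from) ⟩
      g (from (to x)) + rest g       ≈⟨ +-cong (at g) (sum-cong-≋ λ j → sym (f≈g _ (off j))) ⟩
      g x + rest f                   ≈⟨ +-congˡ (+-identityˡ _) ⟨
      g x + (0# + rest f)            ≈⟨ +-congˡ (+-congʳ (trans (at f) fx≈0)) ⟨
      g x + (f (from (to x)) + rest f) ≈⟨ +-congˡ (sum-remove {i = to x} (f ∘ from)) ⟨
      g x + ∑ f                      ∎
      where
      rest : (A → Carrier) → Carrier
      rest h = sum (λ j → h (from (punchIn (to x) j)))

      at : ∀ (h : A → Carrier) → h (from (to x)) ≈ h x
      at h = reflexive (≡.cong h (strictlyInverseʳ x))

      off : ∀ j → from (punchIn (to x) j) ≢ x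
      off j e = Fin.punchInᵢ≢i (to x) j
        (≡.trans (≡.sym (strictlyInverseˡ (punchIn (to x) j))) (≡.cong to e))

    ∑-single : ∀ f x → (∀ y → y ≢ x → f y ≈ 0#) → ∑ f ≈ f x
    ∑-single f x f≈0 = begin
      ∑ f                  ≈⟨ ∑-isolate (λ _ → 0#) f x refl (λ y y≢x → sym (f≈0 y y≢x)) ⟩
      f x + ∑ (λ _ → 0#)   ≈⟨ +-congˡ (∑-zero (λ _ → refl)) ⟩
      f x + 0#             ≈⟨ +-identityʳ _ ⟩
      f x                  ∎

    ∑-pair : DecidableEquality A → ∀ f x y → x ≢ y →
             (∀ z → z ≢ x → z ≢ y → f z ≈ 0#) → ∑ f ≈ f x + f y
    ∑-pair _≟_ f x y x≢y f≈0 = begin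
      ∑ f       ≈⟨ ∑-isolate g f x g-x g-off ⟩
      f x + ∑ g ≈⟨ +-congˡ (∑-single g y g-rest) ⟩
      f x + g y ≈⟨ +-congˡ (g-off y (x≢y ∘ ≡.sym)) ⟩
      f x + f y ∎
      where
      g : A → Carrier
      g z with z ≟ x
      ... | yes _ = 0#
      ... | no _  = f z
      g-x : g x ≈ 0#
      g-x with x ≟ x
      ... | yes _  = refl
      ... | no x≢x = contradiction ≡.refl x≢x
      g-off : ∀ z → z ≢ x → g z ≈ f z
      g-off z z≢x with z ≟ x
      ... | yes z≡x = contradiction z≡x z≢x
      ... | no _    = refl
      g-rest : ∀ z → z ≢ y → g z ≈ 0#
      g-rest z z≢y with z ≟ x
      ... | yes _  = refl
      ... | no z≢x = f≈0 z z≢x z≢y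

    ∑-involution : ∀ (τ : A → A) → (∀ x → τ (τ x) ≡ x) → ∀ f → ∑ f ≈ ∑ (f ∘ τ)
    ∑-involution τ ττ f = begin
      sum (f ∘ from)                    ≈⟨ sum-permute (f ∘ from) (permutation (to ∘ τ ∘ from) (to ∘ τ ∘ from) inv inv) ⟩
      sum (f ∘ from ∘ to ∘ τ ∘ from)    ≈⟨ ∑-cong {f ∘ from ∘ to ∘ τ} (λ x → reflexive (≡.cong f (strictlyInverseʳ (τ x)))) ⟩
      ∑ (f ∘ τ)                         ∎
      where
      inv : ∀ i → to (τ (from (to (τ (from i))))) ≡ i
      inv i = ≡.trans (≡.cong (to ∘ τ) (strictlyInverseʳ _))
                      (≡.trans (≡.cong to (ττ (from i))) (strictlyInverseˡ i))

    ∑-comm′ : ∀ (f : A → A → Carrier) → ∑ (λ x → ∑ (f x)) ≈ ∑ (λ y → ∑ (λ x → f x y))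
    ∑-comm′ f = ∑-comm (λ i j → f (from i) (from j))

    ∑-*ˡ : ∀ a f → a * ∑ f ≈ ∑ (λ x → a * f x)
    ∑-*ˡ a f = *-distribˡ-sum a (f ∘ from)

    ∑-*ʳ : ∀ a f → ∑ f * a ≈ ∑ (λ x → f x * a)
    ∑-*ʳ a f = *-distribʳ-sum a (f ∘ from)

-- Signs in the field

module Composition {c ℓ} (FP : FanoPlane) (K : Field c ℓ) (2≉0 : CharNot2 K) where
  open FanoPlane FP
  open Geometry FP
  open Field K hiding (zero)
  open Alg FP K
  open Algebra.Properties.Ring ring
  open Algebra.Properties.CommutativeSemigroup *-commutativeSemigroup using (interchange)
  open Relation.Binary.Reasoning.Setoid setoid
  open Algebra.Properties.Semiring.Sum semiring using (sum)
  open Algebra.Solver.Ring.NaturalCoefficients.Default commutativeSemiring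
    using (solve; _:+_; _:*_; _:=_; con)

  ι : Bool → Carrier
  ι false = 1#
  ι true  = - 1#

  ι-xor : ∀ a b → ι (a xor b) ≈ ι a * ι b
  ι-xor false b     = sym (*-identityˡ _)
  ι-xor true  false = sym (*-identityʳ _)
  ι-xor true  true  = begin
    1#         ≈⟨ -‿involutive 1# ⟨
    - - 1#     ≈⟨ -1*x≈-x (- 1#) ⟨
    - 1# * - 1# ∎

  ι-square : ∀ a → ι a * ι a ≈ 1#
  ι-square a = trans (sym (ι-xor a a)) (reflexive (≡.cong ι (Bool.xor-same a)))

  ι-not : ∀ b → ι (not b) ≈ - 1# * ι b
  ι-not b = ι-xor true b

  sgn-ι : ∀ s x → sgn s x ≈ ι (isMinus s) * x
  sgn-ι Sign.+ x = sym (*-identityˡ x)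
  sgn-ι Sign.- x = sym (-1*x≈-x x)

  sgn-sgnBool : ∀ b x → sgn (sgnBool FP b) x ≈ ι b * x
  sgn-sgnBool b x = trans (sgn-ι (sgnBool FP b) x)
    (*-congʳ (reflexive (≡.cong ι (isMinus-sgnBool b))))

  -- The characteristic enters here and in `ι-cancel`.
  double-zero : ∀ {x} → x + x ≈ 0# → x ≈ 0#
  double-zero {x} x+x≈0 with inverse (1# + 1#) 2≉0
  ... | h , 2h≈1 = begin
    x                    ≈⟨ *-identityˡ x ⟨
    1# * x               ≈⟨ *-congʳ 2h≈1 ⟨
    (1# + 1#) * h * x    ≈⟨ solve 2 (λ h x → (con 1 :+ con 1) :* h :* x := h :* (x :+ x)) refl h x ⟩
    h * (x + x)          ≈⟨ *-congˡ x+x≈0 ⟩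
    h * 0#               ≈⟨ zeroʳ h ⟩
    0#                   ∎

  ι-cancel : ∀ a b → ι a + ι b ≈ 0# → a ≡ not b
  ι-cancel false false e = contradiction e 2≉0
  ι-cancel false true  e = ≡.refl
  ι-cancel true  false e = ≡.refl
  ι-cancel true  true  e = contradiction
    (trans (sym (-‿involutive 1#)) (trans (-‿cong (double-zero e)) -0#≈0#)) 1≉0

  ι-cancelˡ : ∀ s {x y} → ι s * x ≈ ι s * y → x ≈ y
  ι-cancelˡ s {x} {y} e = begin
    x                 ≈⟨ unit x ⟨
    ι s * (ι s * x)   ≈⟨ *-congˡ e ⟩
    ι s * (ι s * y)   ≈⟨ unit y ⟩
    y                 ∎
    where
    unit : ∀ z → ι s * (ι s * z) ≈ z
    unit z = trans (sym (*-assoc _ _ _)) (trans (*-congʳ (ι-square s)) (*-identityˡ z))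

  square-ι+ι : ∀ a b → (ι a + ι b) * (ι a + ι b) ≈ (1# + 1#) * (1# + ι (a xor b))
  square-ι+ι a b = begin
    (ι a + ι b) * (ι a + ι b)
      ≈⟨ solve 2 (λ a b → (a :+ b) :* (a :+ b) := a :* a :+ b :* b :+ (a :* b :+ a :* b)) refl (ι a) (ι b) ⟩
    ι a * ι a + ι b * ι b + (ι a * ι b + ι a * ι b)
      ≈⟨ +-cong (+-cong (ι-square a) (ι-square b)) (sym (+-cong (ι-xor a b) (ι-xor a b))) ⟩
    1# + 1# + (ι (a xor b) + ι (a xor b))
      ≈⟨ solve 1 (λ u → con 1 :+ con 1 :+ (u :+ u) := (con 1 :+ con 1) :* (con 1 :+ u)) refl (ι (a xor b)) ⟩
    (1# + 1#) * (1# + ι (a xor b))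
      ∎

  -- Read `p`, `q`, `r` as `n(x)`, `n(y)`, `n(d)` and `a`, `b`, `c`, `d` as `F(x,y)`, `F(x+d,y+d)`,
  -- `F(x,y+d)`, `F(x+d,y)`. The square of a sum of two signs is twice one plus their product.
  -- Cancelling `ι (p xor q)` leaves `2(1 + u) + 2 ι(r) (1 + w) = 2(1 + ι(r))`, that is,
  -- `2(u + ι(r) w) = 0`.
  sign-equation : ∀ p q r a b c d →
    ι (p xor q) * ((ι a + ι b) * (ι a + ι b)) + ι (p xor (q xor r)) * ((ι c + ι d) * (ι c + ι d)) ≈
    (ι p + ι (p xor r)) * (ι q + ι (q xor r)) →
    ι (a xor b) + ι (r xor (c xor d)) ≈ 0#
  sign-equation p q r a b c d e = double-zero (+-cancelˡ two+2r _ _ (begin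
    two+2r + (u + ι (r xor (c xor d)) + (u + ι (r xor (c xor d))))
      ≈⟨ +-congˡ (+-cong (+-congˡ (ι-xor r (c xor d))) (+-congˡ (ι-xor r (c xor d)))) ⟩
    two+2r + (u + ι r * w + (u + ι r * w))
      ≈⟨ solve 3 (λ r u w → (con 1 :+ con 1) :* (con 1 :+ r) :+ (u :+ r :* w :+ (u :+ r :* w)) :=
           (con 1 :+ con 1) :* (con 1 :+ u) :+ r :* ((con 1 :+ con 1) :* (con 1 :+ w))) refl (ι r) u w ⟩
    (1# + 1#) * (1# + u) + ι r * ((1# + 1#) * (1# + w))
      ≈⟨ ι-cancelˡ (p xor q) scaled ⟩
    (ι false + ι r) * (ι false + ι r)
      ≈⟨ square-ι+ι false r ⟩
    two+2r
      ≈⟨ +-identityʳ _ ⟨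
    two+2r + 0#
      ∎))
    where
    u w two+2r : Carrier
    u      = ι (a xor b)
    w      = ι (c xor d)
    two+2r = (1# + 1#) * (1# + ι r)

    scaled : ι (p xor q) * ((1# + 1#) * (1# + u) + ι r * ((1# + 1#) * (1# + w))) ≈
             ι (p xor q) * ((ι false + ι r) * (ι false + ι r))
    scaled = begin
      ι (p xor q) * ((1# + 1#) * (1# + u) + ι r * ((1# + 1#) * (1# + w)))
        ≈⟨ *-congˡ (+-cong (square-ι+ι a b) (*-congˡ (square-ι+ι c d))) ⟨
      ι (p xor q) * ((ι a + ι b) * (ι a + ι b) + ι r * ((ι c + ι d) * (ι c + ι d)))
        ≈⟨ trans (distribˡ _ _ _) (+-congˡ (sym (*-assoc _ _ _))) ⟩
      ι (p xor q) * ((ι a + ι b) * (ι a + ι b)) + ι (p xor q) * ι r * ((ι c + ι d) * (ι c + ι d))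
        ≈⟨ +-congˡ (*-congʳ (trans (sym (ι-xor (p xor q) r)) (reflexive (≡.cong ι (Bool.xor-assoc p q r))))) ⟩
      ι (p xor q) * ((ι a + ι b) * (ι a + ι b)) + ι (p xor (q xor r)) * ((ι c + ι d) * (ι c + ι d))
        ≈⟨ e ⟩
      (ι p + ι (p xor r)) * (ι q + ι (q xor r))
        ≈⟨ *-cong (+-congˡ (ι-xor p r)) (+-congˡ (ι-xor q r)) ⟩
      (ι p + ι p * ι r) * (ι q + ι q * ι r)
        ≈⟨ solve 3 (λ p q r → (p :+ p :* r) :* (q :+ q :* r) :=
             p :* q :* ((con 1 :+ r) :* (con 1 :+ r))) refl (ι p) (ι q) (ι r) ⟩
      ι p * ι q * ((1# + ι r) * (1# + ι r))
        ≈⟨ *-congʳ (ι-xor p q) ⟨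
      ι (p xor q) * ((ι false + ι r) * (ι false + ι r))
        ∎

  module ∑P = FiniteSum K seven
  open FiniteSum K eight

  sumFin-sum : ∀ k h → sumFin FP _+_ 0# k h ≡ sum h
  sumFin-sum zero    h = ≡.refl
  sumFin-sum (suc k) h = ≡.cong (h zero +_) (sumFin-sum k (h ∘ suc))

  ΣP-∑ : ∀ f → ΣP f ≡ ∑P.∑ f
  ΣP-∑ f = ≡.trans (sumFin-sum 7 (f ∘ S.from)) (≡.sym (∑P.∑-def f))

  ∑-split : ∀ f → ∑ f ≡ f nothing + ∑P.∑ (f ∘ just)
  ∑-split f = ≡.trans (∑-def f) (≡.trans (sum-suc (f ∘ Inverse.from eight))
    (≡.cong (f nothing +_) (≡.sym (∑P.∑-def (f ∘ just)))))
    where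
    sum-suc : ∀ {k} (h : Fin (suc k) → Carrier) → sum h ≡ h zero + sum (h ∘ suc)
    sum-suc h = ≡.refl

  ∑-translate : ∀ d f → ∑ f ≈ ∑ (λ x → f (d ⊕ x))
  ∑-translate d = ∑-involution (d ⊕_) (⊕-cancel d)

  normQ-∑ : ∀ n Z → normQ (normOf FP n) Z ≈ ∑ (λ x → ι (⟦ n ⟧ x) * (Z x * Z x))
  normQ-∑ n Z = begin
    Z nothing * Z nothing + ΣP (λ P → sgn (normOf FP n P) (Z (just P) * Z (just P)))
      ≡⟨ ≡.cong (Z nothing * Z nothing +_) (ΣP-∑ _) ⟩
    Z nothing * Z nothing + ∑P.∑ (λ P → sgn (normOf FP n P) (Z (just P) * Z (just P)))
      ≈⟨ +-cong (sym (*-identityˡ _)) (∑P.∑-cong (λ P → sgn-sgnBool (proj₁ n P) _)) ⟩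
    1# * (Z nothing * Z nothing) + ∑P.∑ (λ P → ι (proj₁ n P) * (Z (just P) * Z (just P)))
      ≡⟨ ∑-split _ ⟨
    ∑ (λ x → ι (⟦ n ⟧ x) * (Z x * Z x))
      ∎

  normQ-support : ∀ n X {u v} → u ≢ v → (∀ w → w ≢ u → w ≢ v → X w ≈ 0#) →
    normQ (normOf FP n) X ≈ ι (⟦ n ⟧ u) * (X u * X u) + ι (⟦ n ⟧ v) * (X v * X v)
  normQ-support n X u≢v X≈0 = trans (normQ-∑ n X) (∑-pair _≟ⱽ_ _ _ _ u≢v λ w w≢u w≢v →
    trans (*-congˡ (trans (*-congʳ (X≈0 w w≢u w≢v)) (zeroˡ _))) (zeroʳ _))

  -- The product as a twisted convolution

  module Multiplication (n : Dual FP) (ε : MultFun FP) where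

    F : V FP → V FP → Bool
    F = exponent n ε

    -- `term` is the local function of that name in `mul`, which is recovered by unification:
    -- naming two of the points makes one of the 49 summands `term Z W R P Q` a pattern.
    mutual
      term : 𝕆 → 𝕆 → Point → Point → Point → Carrier
      term = _

      mul-terms : ∀ Z W R → mul (normOf FP n) ε Z W (just R) ≡
        Z nothing * W (just R) + Z (just R) * W nothing + ΣP (λ P → ΣP (λ Q → term Z W R P Q))
      mul-terms Z W R with S.from 0F | S.from 1F
      ... | P | Q = ≡.refl

    term-sum : ∀ Z W {P Q R} → IsSum FP P Q R →
               term Z W R P Q ≈ ι (F (just P) (just Q)) * (Z (just P) * W (just Q))
    term-sum Z W {P} {Q} {R} PQ with isSum? FP P Q R
    ... | yes _ = trans (sgn-ι (ε P Q) _)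
                    (*-congʳ (reflexive (≡.cong ι (≡.sym (exponent-distinct n ε (proj₁ PQ))))))
    ... | no ¬PQ = contradiction PQ ¬PQ

    term-zero : ∀ Z W {P Q R} → ¬ IsSum FP P Q R → term Z W R P Q ≈ 0#
    term-zero Z W {P} {Q} {R} ¬PQ with isSum? FP P Q R
    ... | yes PQ = contradiction PQ ¬PQ
    ... | no _   = refl

    product-term : 𝕆 → 𝕆 → V FP → V FP → Carrier
    product-term Z W x y = ι (F x y) * (Z x * W y)

    -- At `0` the diagonal exponent `1 + n(P)` accounts for `-N(P)`. At a point `R`, the row of
    -- `P ≠ R` in the double sum has at most the entry `Q = P+R`; the row of `R` vanishes, and the
    -- unit term `Z_R W_0` takes its place.
    mul-∑ : ∀ Z W x → mul (normOf FP n) ε Z W x ≈ ∑ (λ y → product-term Z W y (y ⊕ x))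
    mul-∑ Z W nothing = begin
      Z nothing * W nothing - ΣP (λ P → sgn (normOf FP n P) (Z (just P) * W (just P)))
        ≡⟨ ≡.cong (λ s → Z nothing * W nothing - s) (ΣP-∑ _) ⟩
      Z nothing * W nothing - ∑P.∑ (λ P → sgn (normOf FP n P) (Z (just P) * W (just P)))
        ≈⟨ +-cong (sym (*-identityˡ _)) (sym (-1*x≈-x _)) ⟩
      1# * (Z nothing * W nothing) + - 1# * ∑P.∑ (λ P → sgn (normOf FP n P) (Z (just P) * W (just P)))
        ≈⟨ +-congˡ (trans (∑P.∑-*ˡ _ _) (∑P.∑-cong diagonal)) ⟩
      1# * (Z nothing * W nothing) + ∑P.∑ (λ P → product-term Z W (just P) (just P))
        ≡⟨ ∑-split _ ⟨
      ∑ (λ y → product-term Z W y (y ⊕ nothing))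
        ∎
      where
      diagonal : ∀ P → - 1# * sgn (normOf FP n P) (Z (just P) * W (just P)) ≈
                       product-term Z W (just P) (just P)
      diagonal P = begin
        - 1# * sgn (normOf FP n P) (Z (just P) * W (just P))  ≈⟨ *-congˡ (sgn-sgnBool (proj₁ n P) _) ⟩
        - 1# * (ι (proj₁ n P) * (Z (just P) * W (just P)))    ≈⟨ *-assoc _ _ _ ⟨
        - 1# * ι (proj₁ n P) * (Z (just P) * W (just P))      ≈⟨ *-congʳ (ι-not (proj₁ n P)) ⟨
        ι (not (proj₁ n P)) * (Z (just P) * W (just P))       ≡⟨ ≡.cong (λ b → ι b * (Z (just P) * W (just P))) (exponent-diagonal n ε P) ⟨
        product-term Z W (just P) (just P)                    ∎
    mul-∑ Z W (just R) = begin
      mul (normOf FP n) ε Z W (just R)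
        ≡⟨ mul-terms Z W R ⟩
      Z nothing * W (just R) + Z (just R) * W nothing + ΣP (λ P → ΣP (term Z W R P))
        ≡⟨ ≡.cong (Z nothing * W (just R) + Z (just R) * W nothing +_) (ΣP-∑ _) ⟩
      Z nothing * W (just R) + Z (just R) * W nothing + ∑P.∑ (λ P → ΣP (term Z W R P))
        ≈⟨ +-congˡ (∑P.∑-cong (λ P → reflexive (ΣP-∑ _))) ⟩
      Z nothing * W (just R) + Z (just R) * W nothing + ∑P.∑ row
        ≈⟨ +-assoc _ _ _ ⟩
      Z nothing * W (just R) + (Z (just R) * W nothing + ∑P.∑ row)
        ≈⟨ +-cong (sym (*-identityˡ _)) (+-congʳ at-R) ⟩
      product-term Z W nothing (just R) + (product-term Z W (just R) (just R ⊕ just R) + ∑P.∑ row)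
        ≈⟨ +-congˡ (∑P.∑-isolate row (λ P → product-term Z W (just P) (just P ⊕ just R)) R row-R row-off) ⟨
      product-term Z W nothing (just R) + ∑P.∑ (λ P → product-term Z W (just P) (just P ⊕ just R))
        ≡⟨ ∑-split _ ⟨
      ∑ (λ y → product-term Z W y (y ⊕ just R))
        ∎
      where
      row : Point → Carrier
      row P = ∑P.∑ (term Z W R P)

      at-R : Z (just R) * W nothing ≈ product-term Z W (just R) (just R ⊕ just R)
      at-R = trans (sym (*-identityˡ _))
        (reflexive (≡.cong (product-term Z W (just R)) (≡.sym (⊕-self (just R)))))

      row-R : row R ≈ 0#
      row-R = ∑P.∑-zero (λ Q → term-zero Z W (λ (_ , R≢R , _) → R≢R ≡.refl))

      row-off : ∀ P → P ≢ R → row P ≈ product-term Z W (just P) (just P ⊕ just R)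
      row-off P P≢R = let Q , PR = third P R P≢R in begin
        row P                                           ≈⟨ ∑P.∑-single (term Z W R P) Q (λ T T≢Q → term-zero Z W
                                                             (λ PT → T≢Q (sum-unique (sum-rotate PT) PR))) ⟩
        term Z W R P Q                                  ≈⟨ term-sum Z W (sum-rotate PR) ⟩
        product-term Z W (just P) (just Q)              ≡⟨ ≡.cong (product-term Z W (just P)) (⊕-sum PR) ⟨
        product-term Z W (just P) (just P ⊕ just R)     ∎

    -- The exchange identity implies composition

    module _ (exchange : Exchange n ε) (Z W : 𝕆) where

      sign : V FP → V FP → V FP → Bool
      sign d x y = ⟦ n ⟧ (x ⊕ y) xor (F x y xor F (x ⊕ d) (y ⊕ d))

      monomial : V FP → V FP → V FP → Carrier
      monomial d x y = (Z x * W y) * (Z (x ⊕ d) * W (y ⊕ d))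

      -- Squaring the coefficient at `u` gives a sum over pairs `x`, `x+d`. With `y = x+u` the
      -- indices of `W` are `y` and `y+d`, so `d` measures the distance between the two products
      -- multiplied.
      normQ-expand : normQ (normOf FP n) (mul (normOf FP n) ε Z W) ≈
                     ∑ (λ d → ∑ (λ x → ∑ (λ y → ι (sign d x y) * monomial d x y)))
      normQ-expand = begin
        normQ (normOf FP n) (mul (normOf FP n) ε Z W)
          ≈⟨ normQ-∑ n _ ⟩
        ∑ (λ u → ι (⟦ n ⟧ u) * (M u * M u))
          ≈⟨ ∑-cong square ⟩
        ∑ (λ u → ∑ (λ x → ∑ (λ d → quartic d x u)))
          ≈⟨ ∑-comm′ _ ⟩
        ∑ (λ x → ∑ (λ u → ∑ (λ d → quartic d x u)))
          ≈⟨ ∑-cong (λ x → ∑-comm′ _) ⟩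
        ∑ (λ x → ∑ (λ d → ∑ (λ u → quartic d x u)))
          ≈⟨ ∑-comm′ _ ⟩
        ∑ (λ d → ∑ (λ x → ∑ (λ u → quartic d x u)))
          ≈⟨ ∑-cong (λ d → ∑-cong (λ x → trans (∑-translate x _) (∑-cong (collect d x)))) ⟩
        ∑ (λ d → ∑ (λ x → ∑ (λ y → ι (sign d x y) * monomial d x y)))
          ∎
        where
        M : V FP → Carrier
        M = mul (normOf FP n) ε Z W

        a : V FP → V FP → Carrier
        a x u = product-term Z W x (x ⊕ u)

        quartic : V FP → V FP → V FP → Carrier
        quartic d x u = ι (⟦ n ⟧ u) * (a x u * a (x ⊕ d) u)

        square : ∀ u → ι (⟦ n ⟧ u) * (M u * M u) ≈ ∑ (λ x → ∑ (λ d → quartic d x u))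
        square u = begin
          ι (⟦ n ⟧ u) * (M u * M u)
            ≈⟨ *-congˡ (*-cong (mul-∑ Z W u) (mul-∑ Z W u)) ⟩
          ι (⟦ n ⟧ u) * (∑ (λ x → a x u) * ∑ (λ x → a x u))
            ≈⟨ *-congˡ (∑-*ʳ _ _) ⟩
          ι (⟦ n ⟧ u) * ∑ (λ x → a x u * ∑ (λ y → a y u))
            ≈⟨ ∑-*ˡ _ _ ⟩
          ∑ (λ x → ι (⟦ n ⟧ u) * (a x u * ∑ (λ y → a y u)))
            ≈⟨ ∑-cong (λ x → *-congˡ (trans (*-congˡ (∑-translate x _)) (∑-*ˡ _ _))) ⟩
          ∑ (λ x → ι (⟦ n ⟧ u) * ∑ (λ d → a x u * a (x ⊕ d) u))
            ≈⟨ ∑-cong (λ x → ∑-*ˡ _ _) ⟩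
          ∑ (λ x → ∑ (λ d → quartic d x u))
            ∎

        collect : ∀ d x y → quartic d x (x ⊕ y) ≈ ι (sign d x y) * monomial d x y
        collect d x y = begin
          ι (⟦ n ⟧ (x ⊕ y)) * (product-term Z W x (x ⊕ (x ⊕ y)) * product-term Z W (x ⊕ d) (x ⊕ d ⊕ (x ⊕ y)))
            ≡⟨ ≡.cong₂ (λ v w → ι (⟦ n ⟧ (x ⊕ y)) * (product-term Z W x v * product-term Z W (x ⊕ d) w))
                 (⊕-cancel x y) (⊕-middle x d y) ⟩
          ι (⟦ n ⟧ (x ⊕ y)) * (ι (F x y) * (Z x * W y) * (ι (F (x ⊕ d) (y ⊕ d)) * (Z (x ⊕ d) * W (y ⊕ d))))
            ≈⟨ *-congˡ (interchange _ _ _ _) ⟩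
          ι (⟦ n ⟧ (x ⊕ y)) * (ι (F x y) * ι (F (x ⊕ d) (y ⊕ d)) * monomial d x y)
            ≈⟨ *-congˡ (*-congʳ (ι-xor (F x y) (F (x ⊕ d) (y ⊕ d)))) ⟨
          ι (⟦ n ⟧ (x ⊕ y)) * (ι (F x y xor F (x ⊕ d) (y ⊕ d)) * monomial d x y)
            ≈⟨ *-assoc _ _ _ ⟨
          ι (⟦ n ⟧ (x ⊕ y)) * ι (F x y xor F (x ⊕ d) (y ⊕ d)) * monomial d x y
            ≈⟨ *-congʳ (ι-xor (⟦ n ⟧ (x ⊕ y)) _) ⟨
          ι (sign d x y) * monomial d x y
            ∎

      sign-flip : ∀ d x y → d ≢ nothing → sign d x (d ⊕ y) ≡ not (sign d x y)
      sign-flip d x y d≢0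
        rewrite ⊕-comm d y | ⊕-cancelʳ y d | ≡.sym (⊕-assoc x y d) | ⟦⟧-⊕ n (x ⊕ y) d
        = flip-Bool (⟦ n ⟧ (x ⊕ y)) (⟦ n ⟧ d) (F x y) (F (x ⊕ d) (y ⊕ d)) (F x (y ⊕ d)) (F (x ⊕ d) y)
            (exchange d x y d≢0)

      monomial-flip : ∀ d x y → monomial d x (d ⊕ y) ≈ monomial d x y
      monomial-flip d x y rewrite ⊕-comm d y | ⊕-cancelʳ y d =
        solve 4 (λ z w z′ w′ → (z :* w′) :* (z′ :* w) := (z :* w) :* (z′ :* w′)) refl
          (Z x) (W y) (Z (x ⊕ d)) (W (y ⊕ d))

      -- The translation `y ↦ d+y` swaps the two `W` factors, which preserves the monomial, and
      -- reverses its sign. The inner sum is its own negative.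
      off-diagonal : ∀ d → d ≢ nothing → ∑ (λ x → ∑ (λ y → ι (sign d x y) * monomial d x y)) ≈ 0#
      off-diagonal d d≢0 = ∑-zero λ x → double-zero (begin
        ∑ (t x) + ∑ (t x)                ≈⟨ +-congʳ (*-identityˡ _) ⟨
        1# * ∑ (t x) + ∑ (t x)           ≈⟨ +-congˡ (∑-translate d (t x)) ⟩
        1# * ∑ (t x) + ∑ (λ y → t x (d ⊕ y)) ≈⟨ +-congˡ (∑-cong (flip x)) ⟩
        1# * ∑ (t x) + ∑ (λ y → - 1# * t x y) ≈⟨ +-congˡ (∑-*ˡ _ _) ⟨
        1# * ∑ (t x) + - 1# * ∑ (t x)    ≈⟨ distribʳ _ _ _ ⟨
        (1# - 1#) * ∑ (t x)              ≈⟨ *-congʳ (-‿inverseʳ 1#) ⟩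
        0# * ∑ (t x)                     ≈⟨ zeroˡ _ ⟩
        0#                               ∎)
        where
        t : V FP → V FP → Carrier
        t x y = ι (sign d x y) * monomial d x y

        flip : ∀ x y → t x (d ⊕ y) ≈ - 1# * t x y
        flip x y = begin
          ι (sign d x (d ⊕ y)) * monomial d x (d ⊕ y) ≈⟨ *-cong (reflexive (≡.cong ι (sign-flip d x y d≢0))) (monomial-flip d x y) ⟩
          ι (not (sign d x y)) * monomial d x y       ≈⟨ *-congʳ (ι-not (sign d x y)) ⟩
          - 1# * ι (sign d x y) * monomial d x y      ≈⟨ *-assoc _ _ _ ⟩
          - 1# * t x y                                ∎

      -- At `d = 0` the two values of `F` cancel, and additivity of `n` separates `x` from `y`.
      diagonal : ∀ x y → ι (sign nothing x y) * monomial nothing x y ≈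
                         ι (⟦ n ⟧ x) * (Z x * Z x) * (ι (⟦ n ⟧ y) * (W y * W y))
      diagonal x y rewrite ⊕-identityʳ x | ⊕-identityʳ y | Bool.xor-same (F x y)
                         | Bool.xor-identityʳ (⟦ n ⟧ (x ⊕ y)) | ⟦⟧-⊕ n x y = begin
        ι (⟦ n ⟧ x xor ⟦ n ⟧ y) * ((Z x * W y) * (Z x * W y))
          ≈⟨ *-congʳ (ι-xor (⟦ n ⟧ x) (⟦ n ⟧ y)) ⟩
        ι (⟦ n ⟧ x) * ι (⟦ n ⟧ y) * ((Z x * W y) * (Z x * W y))
          ≈⟨ solve 4 (λ p q z w → p :* q :* ((z :* w) :* (z :* w)) := p :* (z :* z) :* (q :* (w :* w))) refl
               (ι (⟦ n ⟧ x)) (ι (⟦ n ⟧ y)) (Z x) (W y) ⟩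
        ι (⟦ n ⟧ x) * (Z x * Z x) * (ι (⟦ n ⟧ y) * (W y * W y))
          ∎

      normQ-mul : normQ (normOf FP n) (mul (normOf FP n) ε Z W) ≈
                  normQ (normOf FP n) Z * normQ (normOf FP n) W
      normQ-mul = begin
        normQ (normOf FP n) (mul (normOf FP n) ε Z W)
          ≈⟨ normQ-expand ⟩
        ∑ (λ d → ∑ (λ x → ∑ (λ y → ι (sign d x y) * monomial d x y)))
          ≈⟨ ∑-single _ nothing off-diagonal ⟩
        ∑ (λ x → ∑ (λ y → ι (sign nothing x y) * monomial nothing x y))
          ≈⟨ ∑-cong (λ x → ∑-cong (diagonal x)) ⟩
        ∑ (λ x → ∑ (λ y → ι (⟦ n ⟧ x) * (Z x * Z x) * (ι (⟦ n ⟧ y) * (W y * W y))))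
          ≈⟨ ∑-cong (λ x → ∑-*ˡ _ _) ⟨
        ∑ (λ x → ι (⟦ n ⟧ x) * (Z x * Z x) * ∑ (λ y → ι (⟦ n ⟧ y) * (W y * W y)))
          ≈⟨ ∑-*ʳ _ _ ⟨
        ∑ (λ x → ι (⟦ n ⟧ x) * (Z x * Z x)) * ∑ (λ y → ι (⟦ n ⟧ y) * (W y * W y))
          ≈⟨ *-cong (normQ-∑ n Z) (normQ-∑ n W) ⟨
        normQ (normOf FP n) Z * normQ (normOf FP n) W
          ∎

    exchange⇒composition : Exchange n ε → IsComposition (normOf FP n) ε
    exchange⇒composition = normQ-mul

    -- Composition implies the exchange identity, by evaluation at test elements

    module _ (d x y : V FP) (d≢0 : d ≢ nothing) where

      -- The element `e_u + e_(u+d)`. The product of those at `x` and `y` involves exactly the four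
      -- exponents of the exchange identity.
      pair : V FP → V FP → Carrier
      pair u v with v ≟ⱽ u | v ≟ⱽ u ⊕ d
      ... | yes _ | _     = 1#
      ... | no _  | yes _ = 1#
      ... | no _  | no _  = 0#

      pair-fst : ∀ u → pair u u ≡ 1#
      pair-fst u with u ≟ⱽ u
      ... | yes _  = ≡.refl
      ... | no u≢u = contradiction ≡.refl u≢u

      pair-snd : ∀ u → pair u (u ⊕ d) ≡ 1#
      pair-snd u with u ⊕ d ≟ⱽ u | u ⊕ d ≟ⱽ u ⊕ d
      ... | yes _ | _     = ≡.refl
      ... | no _  | yes _ = ≡.refl
      ... | no _  | no ¬e = contradiction ≡.refl ¬e

      pair-off : ∀ u {v} → v ≢ u → v ≢ u ⊕ d → pair u v ≡ 0#
      pair-off u {v} v≢u v≢u⊕d with v ≟ⱽ u | v ≟ⱽ u ⊕ d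
      ... | yes e | _     = contradiction e v≢u
      ... | no _  | yes e = contradiction e v≢u⊕d
      ... | no _  | no _  = ≡.refl

      ≢-translate : ∀ u → u ≢ u ⊕ d
      ≢-translate u e = d≢0 (≡.trans (≡.sym (⊕-cancel u d)) (≡.trans (≡.cong (u ⊕_) (≡.sym e)) (⊕-self u)))

      normQ-pair : ∀ u → normQ (normOf FP n) (pair u) ≈ ι (⟦ n ⟧ u) + ι (⟦ n ⟧ u xor ⟦ n ⟧ d)
      normQ-pair u = begin
        normQ (normOf FP n) (pair u)
          ≈⟨ normQ-support n (pair u) (≢-translate u) (λ v v≢u v≢u⊕d → reflexive (pair-off u v≢u v≢u⊕d)) ⟩
        ι (⟦ n ⟧ u) * (pair u u * pair u u) + ι (⟦ n ⟧ (u ⊕ d)) * (pair u (u ⊕ d) * pair u (u ⊕ d))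
          ≡⟨ ≡.cong₂ (λ a b → ι (⟦ n ⟧ u) * (a * a) + ι (⟦ n ⟧ (u ⊕ d)) * (b * b)) (pair-fst u) (pair-snd u) ⟩
        ι (⟦ n ⟧ u) * (1# * 1#) + ι (⟦ n ⟧ (u ⊕ d)) * (1# * 1#)
          ≈⟨ +-cong (one _) (one _) ⟩
        ι (⟦ n ⟧ u) + ι (⟦ n ⟧ (u ⊕ d))
          ≡⟨ ≡.cong (λ b → ι (⟦ n ⟧ u) + ι b) (⟦⟧-⊕ n u d) ⟩
        ι (⟦ n ⟧ u) + ι (⟦ n ⟧ u xor ⟦ n ⟧ d)
          ∎
        where
        one : ∀ a → a * (1# * 1#) ≈ a
        one a = trans (*-congˡ (*-identityˡ 1#)) (*-identityʳ a)

      M-two : ∀ u → mul (normOf FP n) ε (pair x) (pair y) u ≈ ι (F x (x ⊕ u)) * pair y (x ⊕ u) + ι (F (x ⊕ d) (x ⊕ d ⊕ u)) * pair y (x ⊕ d ⊕ u)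
      M-two u = begin
        mul (normOf FP n) ε (pair x) (pair y) u
          ≈⟨ mul-∑ (pair x) (pair y) u ⟩
        ∑ (λ v → product-term (pair x) (pair y) v (v ⊕ u))
          ≈⟨ ∑-pair _≟ⱽ_ _ x (x ⊕ d) (≢-translate x) (λ v v≢x v≢x⊕d →
               trans (*-congˡ (trans (*-congʳ (reflexive (pair-off x v≢x v≢x⊕d))) (zeroˡ _))) (zeroʳ _)) ⟩
        product-term (pair x) (pair y) x (x ⊕ u) + product-term (pair x) (pair y) (x ⊕ d) (x ⊕ d ⊕ u)
          ≈⟨ +-cong (*-congˡ (trans (*-congʳ (reflexive (pair-fst x))) (*-identityˡ _)))
                    (*-congˡ (trans (*-congʳ (reflexive (pair-snd x))) (*-identityˡ _))) ⟩
        ι (F x (x ⊕ u)) * pair y (x ⊕ u) + ι (F (x ⊕ d) (x ⊕ d ⊕ u)) * pair y (x ⊕ d ⊕ u)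
          ∎

      M-at : ∀ {u v w} → x ⊕ u ≡ v → x ⊕ d ⊕ u ≡ w → pair y v ≡ 1# → pair y w ≡ 1# →
             mul (normOf FP n) ε (pair x) (pair y) u ≈ ι (F x v) + ι (F (x ⊕ d) w)
      M-at {u} ≡.refl ≡.refl v₁ w₁ = trans (M-two u)
        (+-cong (trans (*-congˡ (reflexive v₁)) (*-identityʳ _)) (trans (*-congˡ (reflexive w₁)) (*-identityʳ _)))

      -- A basis product contributes at `u` only if `u` is an element of `x`, `x+d` plus an element
      -- of `y`, `y+d`; these four sums take only two values.
      M-off : ∀ u → u ≢ x ⊕ y → u ≢ x ⊕ (y ⊕ d) → mul (normOf FP n) ε (pair x) (pair y) u ≈ 0#
      M-off u u≢ u≢′ = begin
        mul (normOf FP n) ε (pair x) (pair y) u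
          ≈⟨ M-two u ⟩
        ι (F x (x ⊕ u)) * pair y (x ⊕ u) + ι (F (x ⊕ d) (x ⊕ d ⊕ u)) * pair y (x ⊕ d ⊕ u)
          ≡⟨ ≡.cong₂ (λ a b → ι (F x (x ⊕ u)) * a + ι (F (x ⊕ d) (x ⊕ d ⊕ u)) * b)
               (pair-off y (u≢ ∘ move x) (u≢′ ∘ move x))
               (pair-off y (λ e → u≢′ (≡.trans (move (x ⊕ d) e) x⊕d⊕y≡))
                           (λ e → u≢ (≡.trans (move (x ⊕ d) e) x⊕d⊕[y⊕d]≡))) ⟩
        ι (F x (x ⊕ u)) * 0# + ι (F (x ⊕ d) (x ⊕ d ⊕ u)) * 0#
          ≈⟨ +-cong (zeroʳ _) (zeroʳ _) ⟩
        0# + 0#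
          ≈⟨ +-identityˡ 0# ⟩
        0#
          ∎
        where
        move : ∀ v {w} → v ⊕ u ≡ w → u ≡ v ⊕ w
        move v ≡.refl = ≡.sym (⊕-cancel v u)

        x⊕d⊕y≡ : x ⊕ d ⊕ y ≡ x ⊕ (y ⊕ d)
        x⊕d⊕y≡ = ≡.trans (⊕-assoc x d y) (≡.cong (x ⊕_) (⊕-comm d y))

        x⊕d⊕[y⊕d]≡ : x ⊕ d ⊕ (y ⊕ d) ≡ x ⊕ y
        x⊕d⊕[y⊕d]≡ = ≡.trans (⊕-assoc x d (y ⊕ d))
          (≡.cong (x ⊕_) (≡.trans (≡.cong (d ⊕_) (⊕-comm y d)) (⊕-cancel d y)))

      normQ-product : normQ (normOf FP n) (mul (normOf FP n) ε (pair x) (pair y)) ≈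
        ι (⟦ n ⟧ x xor ⟦ n ⟧ y) * ((ι (F x y) + ι (F (x ⊕ d) (y ⊕ d))) * (ι (F x y) + ι (F (x ⊕ d) (y ⊕ d)))) +
        ι (⟦ n ⟧ x xor (⟦ n ⟧ y xor ⟦ n ⟧ d)) *
          ((ι (F x (y ⊕ d)) + ι (F (x ⊕ d) y)) * (ι (F x (y ⊕ d)) + ι (F (x ⊕ d) y)))
      normQ-product = begin
        normQ (normOf FP n) (mul (normOf FP n) ε (pair x) (pair y))
          ≈⟨ normQ-support n (mul (normOf FP n) ε (pair x) (pair y))
               (λ e → ≢-translate (x ⊕ y) (≡.trans e (≡.sym (⊕-assoc x y d)))) M-off ⟩
        ι (⟦ n ⟧ (x ⊕ y)) * (mul (normOf FP n) ε (pair x) (pair y) (x ⊕ y) * mul (normOf FP n) ε (pair x) (pair y) (x ⊕ y)) +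
        ι (⟦ n ⟧ (x ⊕ (y ⊕ d))) * (mul (normOf FP n) ε (pair x) (pair y) (x ⊕ (y ⊕ d)) * mul (normOf FP n) ε (pair x) (pair y) (x ⊕ (y ⊕ d)))
          ≈⟨ +-cong (*-cong (reflexive (≡.cong ι (⟦⟧-⊕ n x y))) (*-cong M₁ M₁))
                    (*-cong (reflexive (≡.cong ι (≡.trans (⟦⟧-⊕ n x (y ⊕ d)) (≡.cong (⟦ n ⟧ x xor_) (⟦⟧-⊕ n y d)))))
                            (*-cong M₂ M₂)) ⟩
        _ ∎
        where
        M₁ : mul (normOf FP n) ε (pair x) (pair y) (x ⊕ y) ≈ ι (F x y) + ι (F (x ⊕ d) (y ⊕ d))
        M₁ = M-at (⊕-cancel x y) (⊕-middle x d y) (pair-fst y) (pair-snd y)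

        M₂ : mul (normOf FP n) ε (pair x) (pair y) (x ⊕ (y ⊕ d)) ≈ ι (F x (y ⊕ d)) + ι (F (x ⊕ d) y)
        M₂ = M-at (⊕-cancel x (y ⊕ d)) (≡.trans (⊕-middle x d (y ⊕ d)) (⊕-cancelʳ y d)) (pair-snd y) (pair-fst y)

      exchange-at : IsComposition (normOf FP n) ε →
        ⟦ n ⟧ d xor (F x y xor F (x ⊕ d) (y ⊕ d)) ≡ not (F x (y ⊕ d) xor F (x ⊕ d) y)
      exchange-at composition = exchange-terms-Bool (⟦ n ⟧ d) (F x y) (F (x ⊕ d) (y ⊕ d)) (F x (y ⊕ d)) (F (x ⊕ d) y)
        (ι-cancel _ _ (sign-equation (⟦ n ⟧ x) (⟦ n ⟧ y) (⟦ n ⟧ d) (F x y) (F (x ⊕ d) (y ⊕ d)) (F x (y ⊕ d)) (F (x ⊕ d) y)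
          (begin
            _ ≈⟨ normQ-product ⟨
            normQ (normOf FP n) (mul (normOf FP n) ε (pair x) (pair y)) ≈⟨ composition (pair x) (pair y) ⟩
            normQ (normOf FP n) (pair x) * normQ (normOf FP n) (pair y) ≈⟨ *-cong (normQ-pair x) (normQ-pair y) ⟩
            _ ∎)))

    composition⇒exchange : IsComposition (normOf FP n) ε → Exchange n ε
    composition⇒exchange composition d x y d≢0 = exchange-at d x y d≢0 composition

  -- Passage between the two signs and the classification

  opp-composition : ∀ n {ε} → IsMultFactor FP ε →
                    IsComposition (normOf FP n) ε → IsComposition (normOf FP n) (opp ε)
  opp-composition n {ε} anti composition = Multiplication.exchange⇒composition n (opp ε)
    (exchange-opp n anti (Multiplication.composition⇒exchange n ε composition))

  plus⇒minus : ∀ n ε → InPlus n ε → InMinus n (opp ε)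
  plus⇒minus n ε (anti , composition , lines , source) =
    opp-factor anti , opp-composition n anti composition ,
    (λ n≡0 P → IsLineSet-map future⇒past past⇒future (lines n≡0 P)) ,
    (λ n≢0 → source-map future⇒past past⇒future (source n≢0))
    where
    future⇒past : ∀ {P Q} → InFuture FP ε P Q → InPast FP (opp ε) P Q
    future⇒past (Q≢P , plus) = Q≢P , ≡.cong Sign.opposite plus

    past⇒future : ∀ {P Q} → InPast FP (opp ε) P Q → InFuture FP ε P Q
    past⇒future {P} {Q} (Q≢P , minus) = Q≢P , Sign.opposite-injective minus

  minus⇒plus : ∀ n ε → InMinus n ε → InPlus n (opp ε)
  minus⇒plus n ε (anti , composition , lines , source) =
    opp-factor anti , opp-composition n anti composition ,
    (λ n≡0 P → IsLineSet-map past⇒future future⇒past (lines n≡0 P)) ,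
    (λ n≢0 → source-map past⇒future future⇒past (source n≢0))
    where
    past⇒future : ∀ {P Q} → InPast FP ε P Q → InFuture FP (opp ε) P Q
    past⇒future (Q≢P , minus) = Q≢P , ≡.cong Sign.opposite minus

    future⇒past : ∀ {P Q} → InFuture FP (opp ε) P Q → InPast FP ε P Q
    future⇒past (Q≢P , plus) = Q≢P , Sign.opposite-injective plus

  oriented⇒plus : ∀ n (α : Oriented FP n) → InPlus n (eOf FP (proj₁ α))
  oriented⇒plus n or = factor , Multiplication.exchange⇒composition n (eOf FP α) exchange , future-line , source
    where open Orientation n or

  -- Searching the seven points for one with `n P = 1` decides which clause of `InPlus` applies.
  plus⇒additive : ∀ n ε → InPlus n ε → Additive ε n
  plus⇒additive n ε (anti , composition , lines , source) = case any-point? (λ P → proj₁ n P Bool.≟ true) of λ where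
    (no none)      → let n≡0 = λ P → Bool.¬-not (none ∘ (P ,_)) in lines-additive n ε n≡0 (lines n≡0)
    (yes (P , nP)) →
      let S , future , _ = source (λ n≡0 → contradiction (≡.trans (≡.sym (n≡0 P)) nP) λ ())
      in Source.additive n ε (Multiplication.composition⇒exchange n ε composition) S future

  plus⇒oriented : ∀ n ε → InPlus n ε → Σ (Oriented FP n) λ α → _≐_ FP ε (eOf FP (proj₁ α))
  plus⇒oriented n ε plus =
    let additive = plus⇒additive n ε plus
    in orient n ε (proj₁ plus) additive , orient-factor n ε (proj₁ plus) additive

theorem4p9 : ∀ {c ℓ : Level} (FP : FanoPlane) (K : Field c ℓ) → CharNot2 K →
    (n : Dual FP) →
    let open Alg FP K in
    ((α : Oriented FP n) →
    InPlus n (eOf FP (proj₁ α)) × InMinus n (negeOf FP (proj₁ α))) ×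
    ((ε : MultFun FP) → InPlus n ε →
    Σ (Oriented FP n) (λ α → _≐_ FP ε (eOf FP (proj₁ α)) ×
    ((β : Oriented FP n) → _≐_ FP ε (eOf FP (proj₁ β)) →
    _≗α_ FP (proj₁ α) (proj₁ β)))) ×
    ((ε : MultFun FP) → InMinus n ε →
    Σ (Oriented FP n) (λ α → _≐_ FP ε (negeOf FP (proj₁ α)) ×
    ((β : Oriented FP n) → _≐_ FP ε (negeOf FP (proj₁ β)) →
    _≗α_ FP (proj₁ α) (proj₁ β))))
theorem4p9 FP K 2≉0 n = from-oriented , from-plus , from-minus
  where
  open Geometry FP
  open Composition FP K 2≉0
  open Alg FP K

  from-oriented : (α : Oriented FP n) → InPlus n (eOf FP (proj₁ α)) × InMinus n (negeOf FP (proj₁ α))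
  from-oriented α = oriented⇒plus n α , plus⇒minus n (eOf FP (proj₁ α)) (oriented⇒plus n α)

  from-plus : (ε : MultFun FP) → InPlus n ε →
    Σ (Oriented FP n) (λ α → _≐_ FP ε (eOf FP (proj₁ α)) ×
      ((β : Oriented FP n) → _≐_ FP ε (eOf FP (proj₁ β)) → _≗α_ FP (proj₁ α) (proj₁ β)))
  from-plus ε plus =
    let α , ε≐α = plus⇒oriented n ε plus
    in α , ε≐α , λ β ε≐β → oriented-unique n α β λ P Q P≢Q →
         ≡.trans (≡.sym (ε≐α P Q P≢Q)) (ε≐β P Q P≢Q)

  from-minus : (ε : MultFun FP) → InMinus n ε →
    Σ (Oriented FP n) (λ α → _≐_ FP ε (negeOf FP (proj₁ α)) ×
      ((β : Oriented FP n) → _≐_ FP ε (negeOf FP (proj₁ β)) → _≗α_ FP (proj₁ α) (proj₁ β)))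
  from-minus ε minus =
    -- `ε = -e^α` is equivalent to `-ε = e^α`, so existence and uniqueness carry over from the case
    -- of `+`.
    let α , ε≐α , unique = from-plus (opp ε) (minus⇒plus n ε minus)
    in α , (λ P Q P≢Q → Sign.opposite-injective (≡.trans (ε≐α P Q P≢Q) (≡.sym (Sign.opposite-involutive _))))
         , λ β ε≐β → unique β λ P Q P≢Q →
             ≡.trans (≡.cong Sign.opposite (ε≐β P Q P≢Q)) (Sign.opposite-involutive _)
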